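{- For all integers $n \geq 0$ and all real $x$, $$c_n(x) = (-1)^n n! \sum_{m=0}^n \frac{\widehat{c}_m}{m!} \binom{x+n-1}{n-m}$$ and $$\widehat{c}_n(x) = n! \sum_{m=0}^n \frac{(-1)^m \, c_m}{m!} \binom{x-m}{n-m}.$$
   Context: For real $z$ and integer $n\ge 0$, $\binom{z}{n} = \frac{z(z-1)\cdots(z-n+1)}{n!}$ (with $\binom{z}{0}=1$). The Cauchy polynomials of the first and second kind are $c_n(x) = n! \int_{0}^{1} \binom{t - x}{n}\, dt$ and $\widehat{c}_n(x) = n! \int_{0}^{1} \binom{x - t}{n}\, dt$, $n \ge 0$; the Cauchy numbers are $c_n = c_n(0)$ and $\widehat{c}_n=\widehat{c}_n(0)$. -}

module Defs where

open import Algebra.Bundles using (CommutativeRing; RawRing)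
import Algebra.Solver.Ring as RingSolver
open import Algebra.Solver.Ring.AlmostCommutativeRing
  using (AlmostCommutativeRing; fromCommutativeRing; _-Raw-AlmostCommutative⟶_)
open import Data.Fin.Base using (zero; suc; inject₁; fromℕ)
open import Data.Integer.Base using (+_; 1ℤ)
open import Data.Maybe.Base using (Maybe; map)
open import Data.Nat.Base as ℕ using (ℕ; zero; suc; _!)
import Data.Nat.Properties as ℕ
open import Data.Product.Base using (∃; _×_; _,_; proj₁; proj₂)
open import Data.Rational.Base as ℚ using (ℚ; 0ℚ; 1ℚ; ½)
import Data.Rational.Properties as ℚ
open import Data.Rational.Solver using (module +-*-Solver)
open import Data.Sum.Base using (inj₁; inj₂)
open import Data.Vec.Functional using (Vector)
open import Function.Base using (_∘_)
open import Level using (0ℓ)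
open import Relation.Binary.Bundles using (Preorder)
open import Relation.Binary.PropositionalEquality as ≡ using (_≡_; refl)
import Relation.Binary.Reasoning.Preorder
open import Relation.Nullary.Decidable using (dec⇒maybe)

private
  module Q = +-*-Solver

abstract

  0<½ : 0ℚ ℚ.< ½
  0<½ = ℚ.positive⁻¹ ½

  0<1 : 0ℚ ℚ.< 1ℚ
  0<1 = ℚ.positive⁻¹ 1ℚ

  *-pos : ∀ {p q} → 0ℚ ℚ.< p → 0ℚ ℚ.< q → 0ℚ ℚ.< p ℚ.* q
  *-pos {p} {q} 0<p 0<q = ℚ.positive⁻¹ (p ℚ.* q)
    {{ℚ.pos*pos⇒pos p {{ℚ.positive 0<p}} q {{ℚ.positive 0<q}}}}

  +-pos : ∀ {p q} → 0ℚ ℚ.< p → 0ℚ ℚ.< q → 0ℚ ℚ.< p ℚ.+ q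
  +-pos = ℚ.+-mono-<

  *-nonNeg : ∀ {p q} → 0ℚ ℚ.≤ p → 0ℚ ℚ.≤ q → 0ℚ ℚ.≤ p ℚ.* q
  *-nonNeg {p} {q} 0≤p 0≤q = ℚ.nonNegative⁻¹ (p ℚ.* q)
    {{ℚ.nonNeg*nonNeg⇒nonNeg p {{ℚ.nonNegative 0≤p}} q {{ℚ.nonNegative 0≤q}}}}

  half-sum : ∀ p → ½ ℚ.* p ℚ.+ ½ ℚ.* p ≡ p
  half-sum = Q.solve 1 (λ p → Q.con ½ Q.:* p Q.:+ Q.con ½ Q.:* p Q.:= p) refl

  half-pos : ∀ {p} → 0ℚ ℚ.< p → 0ℚ ℚ.< ½ ℚ.* p
  half-pos = *-pos 0<½

  divide : ∀ B ε → 0ℚ ℚ.< B → 0ℚ ℚ.< ε → ∃ λ δ → 0ℚ ℚ.< δ × B ℚ.* δ ≡ ε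
  divide B ε 0<B 0<ε = 1/B ℚ.* ε , *-pos 0<1/B 0<ε , (begin
      B ℚ.* (1/B ℚ.* ε)  ≡⟨ ℚ.*-assoc B 1/B ε ⟨
      B ℚ.* 1/B ℚ.* ε    ≡⟨ ≡.cong (ℚ._* ε) (ℚ.*-inverseʳ B {{B≢0}}) ⟩
      1ℚ ℚ.* ε           ≡⟨ ℚ.*-identityˡ ε ⟩
      ε                  ∎)
    where
    open ≡.≡-Reasoning
    B≢0 : ℚ.NonZero B
    B≢0 = ℚ.pos⇒nonZero B {{ℚ.positive 0<B}}
    1/B : ℚ
    1/B = ℚ.1/_ B {{B≢0}}
    0<1/B : 0ℚ ℚ.< 1/B
    0<1/B = ℚ.positive⁻¹ 1/B {{ℚ.1/pos⇒pos B {{ℚ.positive 0<B}}}}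

  p≤∣p∣ : ∀ p → p ℚ.≤ ℚ.∣ p ∣
  p≤∣p∣ p with ℚ.≤-total 0ℚ p
  ... | inj₁ 0≤p = ℚ.≤-reflexive (≡.sym (ℚ.0≤p⇒∣p∣≡p 0≤p))
  ... | inj₂ p≤0 = ℚ.≤-trans p≤0 (ℚ.0≤∣p∣ p)

  -p≤∣p∣ : ∀ p → ℚ.- p ℚ.≤ ℚ.∣ p ∣
  -p≤∣p∣ p = ≡.subst (ℚ.- p ℚ.≤_) (ℚ.∣-p∣≡∣p∣ p) (p≤∣p∣ (ℚ.- p))

  dist-self : ∀ p → ℚ.∣ p ℚ.- p ∣ ≡ 0ℚ
  dist-self p = ≡.cong ℚ.∣_∣ (ℚ.+-inverseʳ p)

  dist-sym : ∀ p q → ℚ.∣ p ℚ.- q ∣ ≡ ℚ.∣ q ℚ.- p ∣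
  dist-sym p q = ≡.trans (≡.sym (ℚ.∣-p∣≡∣p∣ (p ℚ.- q)))
    (≡.cong ℚ.∣_∣ (Q.solve 2 (λ p q → Q.:- (p Q.:- q) Q.:= q Q.:- p) refl p q))

  dist-triangle : ∀ p q r → ℚ.∣ p ℚ.- r ∣ ℚ.≤ ℚ.∣ p ℚ.- q ∣ ℚ.+ ℚ.∣ q ℚ.- r ∣
  dist-triangle p q r = ≡.subst
    (λ s → ℚ.∣ s ∣ ℚ.≤ ℚ.∣ p ℚ.- q ∣ ℚ.+ ℚ.∣ q ℚ.- r ∣)
    (Q.solve 3 (λ p q r → (p Q.:- q) Q.:+ (q Q.:- r) Q.:= p Q.:- r) refl p q r)
    (ℚ.∣p+q∣≤∣p∣+∣q∣ (p ℚ.- q) (q ℚ.- r))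

  dist-+ : ∀ p q p′ q′ →
           ℚ.∣ (p ℚ.+ q) ℚ.- (p′ ℚ.+ q′) ∣ ℚ.≤ ℚ.∣ p ℚ.- p′ ∣ ℚ.+ ℚ.∣ q ℚ.- q′ ∣
  dist-+ p q p′ q′ = ≡.subst
    (λ s → ℚ.∣ s ∣ ℚ.≤ ℚ.∣ p ℚ.- p′ ∣ ℚ.+ ℚ.∣ q ℚ.- q′ ∣)
    (Q.solve 4 (λ p q p′ q′ →
      (p Q.:- p′) Q.:+ (q Q.:- q′) Q.:= (p Q.:+ q) Q.:- (p′ Q.:+ q′)) refl p q p′ q′)
    (ℚ.∣p+q∣≤∣p∣+∣q∣ (p ℚ.- p′) (q ℚ.- q′))

  dist-neg : ∀ p q → ℚ.∣ (ℚ.- p) ℚ.- (ℚ.- q) ∣ ≡ ℚ.∣ p ℚ.- q ∣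
  dist-neg p q = ≡.trans
    (≡.cong ℚ.∣_∣ (Q.solve 2 (λ p q → (Q.:- p) Q.:- (Q.:- q) Q.:= Q.:- (p Q.:- q)) refl p q))
    (ℚ.∣-p∣≡∣p∣ (p ℚ.- q))

  dist-abs : ∀ p q → ℚ.∣ ℚ.∣ p ∣ ℚ.- ℚ.∣ q ∣ ∣ ℚ.≤ ℚ.∣ p ℚ.- q ∣
  dist-abs p q with ℚ.∣p∣≡p∨∣p∣≡-p (ℚ.∣ p ∣ ℚ.- ℚ.∣ q ∣)
  ... | inj₁ eq = ≡.subst (ℚ._≤ ℚ.∣ p ℚ.- q ∣) (≡.sym eq) (one-sided p q)
    where
    one-sided : ∀ p q → ℚ.∣ p ∣ ℚ.- ℚ.∣ q ∣ ℚ.≤ ℚ.∣ p ℚ.- q ∣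
    one-sided p q = begin
      ℚ.∣ p ∣ ℚ.- ℚ.∣ q ∣                             ≡⟨ ≡.cong (λ r → ℚ.∣ r ∣ ℚ.- ℚ.∣ q ∣)
        (Q.solve 2 (λ p q → p Q.:= (p Q.:- q) Q.:+ q) refl p q) ⟩
      ℚ.∣ (p ℚ.- q) ℚ.+ q ∣ ℚ.- ℚ.∣ q ∣               ≤⟨ ℚ.+-monoˡ-≤ (ℚ.- ℚ.∣ q ∣) (ℚ.∣p+q∣≤∣p∣+∣q∣ (p ℚ.- q) q) ⟩
      (ℚ.∣ p ℚ.- q ∣ ℚ.+ ℚ.∣ q ∣) ℚ.- ℚ.∣ q ∣         ≡⟨ Q.solve 2 (λ a b → (a Q.:+ b) Q.:- b Q.:= a) refl ℚ.∣ p ℚ.- q ∣ ℚ.∣ q ∣ ⟩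
      ℚ.∣ p ℚ.- q ∣                                   ∎
      where open ℚ.≤-Reasoning
  ... | inj₂ eq = ≡.subst (ℚ._≤ ℚ.∣ p ℚ.- q ∣) (≡.sym eq) (begin
      ℚ.- (ℚ.∣ p ∣ ℚ.- ℚ.∣ q ∣)                       ≡⟨ Q.solve 2 (λ a b → Q.:- (a Q.:- b) Q.:= b Q.:- a) refl ℚ.∣ p ∣ ℚ.∣ q ∣ ⟩
      ℚ.∣ q ∣ ℚ.- ℚ.∣ p ∣                             ≡⟨ ≡.cong (λ r → ℚ.∣ r ∣ ℚ.- ℚ.∣ p ∣)
        (Q.solve 2 (λ p q → q Q.:= (q Q.:- p) Q.:+ p) refl p q) ⟩
      ℚ.∣ (q ℚ.- p) ℚ.+ p ∣ ℚ.- ℚ.∣ p ∣               ≤⟨ ℚ.+-monoˡ-≤ (ℚ.- ℚ.∣ p ∣) (ℚ.∣p+q∣≤∣p∣+∣q∣ (q ℚ.- p) p) ⟩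
      (ℚ.∣ q ℚ.- p ∣ ℚ.+ ℚ.∣ p ∣) ℚ.- ℚ.∣ p ∣         ≡⟨ Q.solve 2 (λ a b → (a Q.:+ b) Q.:- b Q.:= a) refl ℚ.∣ q ℚ.- p ∣ ℚ.∣ p ∣ ⟩
      ℚ.∣ q ℚ.- p ∣                                   ≡⟨ dist-sym q p ⟩
      ℚ.∣ p ℚ.- q ∣                                   ∎)
      where open ℚ.≤-Reasoning

  *-mono-abs : ∀ {p q A δ} → ℚ.∣ p ∣ ℚ.< A → ℚ.∣ q ∣ ℚ.< δ → ℚ.∣ p ℚ.* q ∣ ℚ.< A ℚ.* δ
  *-mono-abs {p} {q} {A} {δ} p<A q<δ = begin-strict
    ℚ.∣ p ℚ.* q ∣        ≡⟨ ℚ.∣p*q∣≡∣p∣*∣q∣ p q ⟩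
    ℚ.∣ p ∣ ℚ.* ℚ.∣ q ∣  ≤⟨ ℚ.*-monoʳ-≤-nonNeg ℚ.∣ q ∣ {{ℚ.nonNegative (ℚ.0≤∣p∣ q)}} (ℚ.<⇒≤ p<A) ⟩
    A ℚ.* ℚ.∣ q ∣        <⟨ ℚ.*-monoʳ-<-pos A {{ℚ.positive (ℚ.≤-<-trans (ℚ.0≤∣p∣ p) p<A)}} q<δ ⟩
    A ℚ.* δ              ∎
    where open ℚ.≤-Reasoning

  dist-* : ∀ {p q p′ q′ A B δ ε} → ℚ.∣ p ∣ ℚ.< A → ℚ.∣ q′ ∣ ℚ.< B →
           ℚ.∣ p ℚ.- p′ ∣ ℚ.< δ → ℚ.∣ q ℚ.- q′ ∣ ℚ.< δ → (A ℚ.+ B) ℚ.* δ ≡ ε →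
           ℚ.∣ p ℚ.* q ℚ.- p′ ℚ.* q′ ∣ ℚ.< ε
  dist-* {p} {q} {p′} {q′} {A} {B} {δ} {ε} p<A q′<B dp dq eq = begin-strict
    ℚ.∣ p ℚ.* q ℚ.- p′ ℚ.* q′ ∣
      ≡⟨ ≡.cong ℚ.∣_∣ (Q.solve 4 (λ p q p′ q′ →
           p Q.:* q Q.:- p′ Q.:* q′ Q.:= p Q.:* (q Q.:- q′) Q.:+ q′ Q.:* (p Q.:- p′)) refl p q p′ q′) ⟩
    ℚ.∣ p ℚ.* (q ℚ.- q′) ℚ.+ q′ ℚ.* (p ℚ.- p′) ∣
      ≤⟨ ℚ.∣p+q∣≤∣p∣+∣q∣ (p ℚ.* (q ℚ.- q′)) (q′ ℚ.* (p ℚ.- p′)) ⟩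
    ℚ.∣ p ℚ.* (q ℚ.- q′) ∣ ℚ.+ ℚ.∣ q′ ℚ.* (p ℚ.- p′) ∣
      <⟨ ℚ.+-mono-< (*-mono-abs {p} p<A dq) (*-mono-abs {q′} q′<B dp) ⟩
    A ℚ.* δ ℚ.+ B ℚ.* δ
      ≡⟨ ℚ.*-distribʳ-+ δ A B ⟨
    (A ℚ.+ B) ℚ.* δ
      ≡⟨ eq ⟩
    ε ∎
    where open ℚ.≤-Reasoning

  half-< : ∀ {p q ε} → p ℚ.< ½ ℚ.* ε → q ℚ.< ½ ℚ.* ε → p ℚ.+ q ℚ.< ε
  half-< {p} {q} {ε} p< q< = ≡.subst (p ℚ.+ q ℚ.<_) (half-sum ε) (ℚ.+-mono-< p< q<)

Eventually : (ℕ → Set) → Set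
Eventually P = ∃ λ N → ∀ n → N ℕ.≤ n → P n

IsCauchy : (ℕ → ℚ) → Set
IsCauchy s = ∀ ε → 0ℚ ℚ.< ε → ∃ λ N → ∀ m n → N ℕ.≤ m → N ℕ.≤ n →
             ℚ.∣ s m ℚ.- s n ∣ ℚ.< ε

-- Bishop-style reals: Cauchy sequences of rationals, with _≃_ as their equality.
record ℝ : Set where
  no-eta-equality -- so that sums and products, defined by copatterns, do not unfold
  constructor mkℝ
  field
    seq    : ℕ → ℚ
    cauchy : IsCauchy seq

open ℝ public

infix 4 _≃_ _≤_ _<_

record _≃_ (x y : ℝ) : Set where
  constructor mk≃
  field close : ∀ ε → 0ℚ ℚ.< ε → Eventually λ n → ℚ.∣ seq x n ℚ.- seq y n ∣ ℚ.< ε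

record _≤_ (x y : ℝ) : Set where
  constructor mk≤
  field below : ∀ ε → 0ℚ ℚ.< ε → Eventually λ n → seq x n ℚ.< seq y n ℚ.+ ε

record _<_ (x y : ℝ) : Set where
  constructor mk<
  field
    gap     : ℚ
    gap-pos : 0ℚ ℚ.< gap
    apart   : Eventually λ n → seq x n ℚ.+ gap ℚ.< seq y n

open _≃_ public
open _≤_ public
open _<_ public

ev-map : ∀ {P R : ℕ → Set} → (∀ n → P n → R n) → Eventually P → Eventually R
ev-map f (N , p) = N , λ n N≤n → f n (p n N≤n)

ev-zip : ∀ {P R S : ℕ → Set} → (∀ n → P n → R n → S n) →
         Eventually P → Eventually R → Eventually S
ev-zip f (M , p) (N , q) = M ℕ.⊔ N , λ n M⊔N≤n →
  f n (p n (ℕ.≤-trans (ℕ.m≤m⊔n M N) M⊔N≤n)) (q n (ℕ.≤-trans (ℕ.m≤n⊔m M N) M⊔N≤n))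

always : ∀ {P : ℕ → Set} → (∀ n → P n) → Eventually P
always p = 0 , λ n _ → p n

abstract

  bounded : ∀ x → ∃ λ B → 0ℚ ℚ.< B × Eventually λ n → ℚ.∣ seq x n ∣ ℚ.< B
  bounded x with cauchy x 1ℚ 0<1
  ... | N , near = 1ℚ ℚ.+ ℚ.∣ seq x N ∣ , 0<B , N , λ n N≤n → begin-strict
      ℚ.∣ seq x n ∣                              ≡⟨ ≡.cong ℚ.∣_∣ (Q.solve 2 (λ a b → a Q.:= (a Q.:- b) Q.:+ b) refl (seq x n) (seq x N)) ⟩
      ℚ.∣ (seq x n ℚ.- seq x N) ℚ.+ seq x N ∣    ≤⟨ ℚ.∣p+q∣≤∣p∣+∣q∣ (seq x n ℚ.- seq x N) (seq x N) ⟩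
      ℚ.∣ seq x n ℚ.- seq x N ∣ ℚ.+ ℚ.∣ seq x N ∣ <⟨ ℚ.+-monoˡ-< ℚ.∣ seq x N ∣ (near n N N≤n ℕ.≤-refl) ⟩
      1ℚ ℚ.+ ℚ.∣ seq x N ∣                       ∎
    where
    open ℚ.≤-Reasoning
    0<B : 0ℚ ℚ.< 1ℚ ℚ.+ ℚ.∣ seq x N ∣
    0<B = ℚ.+-mono-<-≤ 0<1 (ℚ.0≤∣p∣ (seq x N))

infix  8 -_
infixl 7 _*_ _/!_
infixl 6 _+_ _-_

abstract

  const-cauchy : ∀ p → IsCauchy (λ _ → p)
  const-cauchy p ε 0<ε = 0 , λ _ _ _ _ → ≡.subst (ℚ._< ε) (≡.sym (dist-self p)) 0<ε

  +-cauchy : ∀ x y → IsCauchy (λ n → seq x n ℚ.+ seq y n)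
  +-cauchy x y ε 0<ε =
    let (M , p) = cauchy x (½ ℚ.* ε) (half-pos 0<ε)
        (N , q) = cauchy y (½ ℚ.* ε) (half-pos 0<ε)
    in M ℕ.⊔ N , λ m n m≥ n≥ → ℚ.≤-<-trans
         (dist-+ (seq x m) (seq y m) (seq x n) (seq y n))
         (half-< {ℚ.∣ seq x m ℚ.- seq x n ∣}
           (p m n (ℕ.≤-trans (ℕ.m≤m⊔n M N) m≥) (ℕ.≤-trans (ℕ.m≤m⊔n M N) n≥))
           (q m n (ℕ.≤-trans (ℕ.m≤n⊔m M N) m≥) (ℕ.≤-trans (ℕ.m≤n⊔m M N) n≥)))

  neg-cauchy : ∀ x → IsCauchy (λ n → ℚ.- seq x n)
  neg-cauchy x ε 0<ε =
    let (N , p) = cauchy x ε 0<ε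
    in N , λ m n m≥ n≥ → ≡.subst (ℚ._< ε) (≡.sym (dist-neg (seq x m) (seq x n))) (p m n m≥ n≥)

  *-cauchy : ∀ x y → IsCauchy (λ n → seq x n ℚ.* seq y n)
  *-cauchy x y ε 0<ε =
    let (A , 0<A , K , x<A)  = bounded x
        (B , 0<B , L , y<B)  = bounded y
        (δ , 0<δ , eq)       = divide (A ℚ.+ B) ε (+-pos 0<A 0<B) 0<ε
        (M , p)              = cauchy x δ 0<δ
        (N , q)              = cauchy y δ 0<δ
        K≤ = ℕ.≤-trans (ℕ.m≤m⊔n K L) (ℕ.m≤m⊔n (K ℕ.⊔ L) (M ℕ.⊔ N))
        L≤ = ℕ.≤-trans (ℕ.m≤n⊔m K L) (ℕ.m≤m⊔n (K ℕ.⊔ L) (M ℕ.⊔ N))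
        M≤ = ℕ.≤-trans (ℕ.m≤m⊔n M N) (ℕ.m≤n⊔m (K ℕ.⊔ L) (M ℕ.⊔ N))
        N≤ = ℕ.≤-trans (ℕ.m≤n⊔m M N) (ℕ.m≤n⊔m (K ℕ.⊔ L) (M ℕ.⊔ N))
    in (K ℕ.⊔ L) ℕ.⊔ (M ℕ.⊔ N) , λ m n m≥ n≥ →
         dist-* {p = seq x m} {q′ = seq y n}
           (x<A m (ℕ.≤-trans K≤ m≥)) (y<B n (ℕ.≤-trans L≤ n≥))
           (p m n (ℕ.≤-trans M≤ m≥) (ℕ.≤-trans M≤ n≥))
           (q m n (ℕ.≤-trans N≤ m≥) (ℕ.≤-trans N≤ n≥)) eq

  abs-cauchy : ∀ x → IsCauchy (λ n → ℚ.∣ seq x n ∣)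
  abs-cauchy x ε 0<ε =
    let (N , p) = cauchy x ε 0<ε
    in N , λ m n m≥ n≥ → ℚ.≤-<-trans (dist-abs (seq x m) (seq x n)) (p m n m≥ n≥)

ofℚ : ℚ → ℝ
ofℚ p .seq _  = p
ofℚ p .cauchy = const-cauchy p

ofℕ : ℕ → ℝ
ofℕ n = ofℚ (+ n ℚ./ 1)

0ℝ 1ℝ : ℝ
0ℝ = ofℚ 0ℚ
1ℝ = ofℚ 1ℚ

_+_ _*_ : ℝ → ℝ → ℝ
(x + y) .seq n  = seq x n ℚ.+ seq y n
(x + y) .cauchy = +-cauchy x y
(x * y) .seq n  = seq x n ℚ.* seq y n
(x * y) .cauchy = *-cauchy x y

-_ ∣_∣ : ℝ → ℝ
(- x) .seq n  = ℚ.- seq x n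
(- x) .cauchy = neg-cauchy x
∣ x ∣ .seq n  = ℚ.∣ seq x n ∣
∣ x ∣ .cauchy = abs-cauchy x

_-_ : ℝ → ℝ → ℝ
x - y = x + - y

-- x /! n = x / n!
_/!_ : ℝ → ℕ → ℝ
x /! n = x * ofℚ ((1ℤ ℚ./ n !) {{n ℕ.!≢0}})

abstract

  ≡⇒≃ : ∀ {x y} → (∀ n → seq x n ≡ seq y n) → x ≃ y
  ≡⇒≃ {x} {y} eq = mk≃ λ ε 0<ε → always λ n → ≡.subst (ℚ._< ε)
    (≡.sym (≡.trans (≡.cong (λ p → ℚ.∣ p ℚ.- seq y n ∣) (eq n)) (dist-self (seq y n)))) 0<ε

abstract

  ≃-refl : ∀ {x} → x ≃ x
  ≃-refl = ≡⇒≃ λ _ → refl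

  ≃-sym : ∀ {x y} → x ≃ y → y ≃ x
  ≃-sym {x} {y} x≃y = mk≃ λ ε 0<ε →
    ev-map (λ n → ≡.subst (ℚ._< ε) (dist-sym (seq x n) (seq y n))) (close x≃y ε 0<ε)

  ≃-trans : ∀ {x y z} → x ≃ y → y ≃ z → x ≃ z
  ≃-trans {x} {y} {z} x≃y y≃z = mk≃ λ ε 0<ε →
    ev-zip (λ n p q → ℚ.≤-<-trans (dist-triangle (seq x n) (seq y n) (seq z n)) (half-< p q))
      (close x≃y (½ ℚ.* ε) (half-pos 0<ε)) (close y≃z (½ ℚ.* ε) (half-pos 0<ε))

  +-cong : ∀ {x x′ y y′} → x ≃ x′ → y ≃ y′ → x + y ≃ x′ + y′
  +-cong {x} {x′} {y} {y′} x≃ y≃ = mk≃ λ ε 0<ε →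
    ev-zip (λ n p q → ℚ.≤-<-trans (dist-+ (seq x n) (seq y n) (seq x′ n) (seq y′ n)) (half-< p q))
      (close x≃ (½ ℚ.* ε) (half-pos 0<ε)) (close y≃ (½ ℚ.* ε) (half-pos 0<ε))

  -‿cong : ∀ {x y} → x ≃ y → - x ≃ - y
  -‿cong {x} {y} x≃y = mk≃ λ ε 0<ε →
    ev-map (λ n → ≡.subst (ℚ._< ε) (≡.sym (dist-neg (seq x n) (seq y n)))) (close x≃y ε 0<ε)

  *-cong : ∀ {x x′ y y′} → x ≃ x′ → y ≃ y′ → x * y ≃ x′ * y′
  *-cong {x} {x′} {y} {y′} x≃ y≃ = mk≃ λ ε 0<ε →
    let (A , 0<A , x<A)   = bounded x
        (B , 0<B , y′<B)  = bounded y′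
        (δ , 0<δ , eq)    = divide (A ℚ.+ B) ε (+-pos 0<A 0<B) 0<ε
    in ev-zip (λ n (a , b) (p , q) → dist-* {p = seq x n} {q′ = seq y′ n} a b p q eq)
         (ev-zip (λ _ → _,_) x<A y′<B)
         (ev-zip (λ _ → _,_) (close x≃ δ 0<δ) (close y≃ δ 0<δ))

ℝ-commutativeRing : CommutativeRing 0ℓ 0ℓ
ℝ-commutativeRing = record
  { Carrier = ℝ ; _≈_ = _≃_ ; _+_ = _+_ ; _*_ = _*_ ; -_ = -_ ; 0# = 0ℝ ; 1# = 1ℝ
  ; isCommutativeRing = record
    { isRing = record
      { +-isAbelianGroup = record
        { isGroup = record
          { isMonoid = record
            { isSemigroup = record
              { isMagma = record
                { isEquivalence = record { refl = ≃-refl ; sym = ≃-sym ; trans = ≃-trans }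
                ; ∙-cong = +-cong
                }
              ; assoc = λ x y z → ≡⇒≃ λ n → ℚ.+-assoc (seq x n) (seq y n) (seq z n)
              }
            ; identity = (λ x → ≡⇒≃ λ n → ℚ.+-identityˡ (seq x n))
                       , (λ x → ≡⇒≃ λ n → ℚ.+-identityʳ (seq x n))
            }
          ; inverse = (λ x → ≡⇒≃ λ n → ℚ.+-inverseˡ (seq x n))
                    , (λ x → ≡⇒≃ λ n → ℚ.+-inverseʳ (seq x n))
          ; ⁻¹-cong = -‿cong
          }
        ; comm = λ x y → ≡⇒≃ λ n → ℚ.+-comm (seq x n) (seq y n)
        }
      ; *-cong = *-cong
      ; *-assoc = λ x y z → ≡⇒≃ λ n → ℚ.*-assoc (seq x n) (seq y n) (seq z n)
      ; *-identity = (λ x → ≡⇒≃ λ n → ℚ.*-identityˡ (seq x n))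
                   , (λ x → ≡⇒≃ λ n → ℚ.*-identityʳ (seq x n))
      ; distrib = (λ x y z → ≡⇒≃ λ n → ℚ.*-distribˡ-+ (seq x n) (seq y n) (seq z n))
                , (λ x y z → ≡⇒≃ λ n → ℚ.*-distribʳ-+ (seq x n) (seq y n) (seq z n))
      }
    ; *-comm = λ x y → ≡⇒≃ λ n → ℚ.*-comm (seq x n) (seq y n)
    }
  }

open CommutativeRing ℝ-commutativeRing using (semiring)
open import Algebra.Properties.Semiring.Sum semiring public
  using (sum; sum-syntax; sum⁺-syntax; sum-cong-≋; ∑-distrib-+; *-distribˡ-sum)
open import Algebra.Properties.Semiring.Exp semiring public using (_^_)

ℝ-almostCommutativeRing : AlmostCommutativeRing 0ℓ 0ℓ
ℝ-almostCommutativeRing = fromCommutativeRing ℝ-commutativeRing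

ℚ-rawRing : RawRing 0ℓ 0ℓ
ℚ-rawRing = CommutativeRing.rawRing ℚ.+-*-commutativeRing

ofℚ-homomorphism : ℚ-rawRing -Raw-AlmostCommutative⟶ ℝ-almostCommutativeRing
ofℚ-homomorphism = record
  { ⟦_⟧    = ofℚ
  ; +-homo = λ _ _ → ≡⇒≃ λ _ → refl
  ; *-homo = λ _ _ → ≡⇒≃ λ _ → refl
  ; -‿homo = λ _ → ≡⇒≃ λ _ → refl
  ; 0-homo = ≃-refl
  ; 1-homo = ≃-refl
  }

ofℚ-≟ : ∀ p q → Maybe (ofℚ p ≃ ofℚ q)
ofℚ-≟ p q = map (λ eq → ≡⇒≃ λ _ → eq) (dec⇒maybe (p ℚ.≟ q))

module ℝ-Solver = RingSolver ℚ-rawRing ℝ-almostCommutativeRing ofℚ-homomorphism ofℚ-≟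

private
  module R = ℝ-Solver

abstract

  ≤-pointwise : ∀ {x y} → (∀ n → seq x n ℚ.≤ seq y n) → x ≤ y
  ≤-pointwise {x} {y} x≤y = mk≤ λ ε 0<ε → always λ n → begin-strict
    seq x n          ≤⟨ x≤y n ⟩
    seq y n          ≡⟨ ℚ.+-identityʳ (seq y n) ⟨
    seq y n ℚ.+ 0ℚ   <⟨ ℚ.+-monoʳ-< (seq y n) 0<ε ⟩
    seq y n ℚ.+ ε    ∎
    where open ℚ.≤-Reasoning

  ≃⇒≤ : ∀ {x y} → x ≃ y → x ≤ y
  ≃⇒≤ {x} {y} x≃y = mk≤ λ ε 0<ε → ev-map (λ n near → begin-strict
      seq x n                            ≡⟨ Q.solve 2 (λ a b → a Q.:= b Q.:+ (a Q.:- b)) refl (seq x n) (seq y n) ⟩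
      seq y n ℚ.+ (seq x n ℚ.- seq y n)  ≤⟨ ℚ.+-monoʳ-≤ (seq y n) (p≤∣p∣ (seq x n ℚ.- seq y n)) ⟩
      seq y n ℚ.+ ℚ.∣ seq x n ℚ.- seq y n ∣ <⟨ ℚ.+-monoʳ-< (seq y n) near ⟩
      seq y n ℚ.+ ε                      ∎) (close x≃y ε 0<ε)
    where open ℚ.≤-Reasoning

  ≤-trans : ∀ {x y z} → x ≤ y → y ≤ z → x ≤ z
  ≤-trans {x} {y} {z} x≤y y≤z = mk≤ λ ε 0<ε → ev-zip (λ n p q → begin-strict
      seq x n                              <⟨ p ⟩
      seq y n ℚ.+ ½ ℚ.* ε                  <⟨ ℚ.+-monoˡ-< (½ ℚ.* ε) q ⟩
      (seq z n ℚ.+ ½ ℚ.* ε) ℚ.+ ½ ℚ.* ε    ≡⟨ ℚ.+-assoc (seq z n) (½ ℚ.* ε) (½ ℚ.* ε) ⟩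
      seq z n ℚ.+ (½ ℚ.* ε ℚ.+ ½ ℚ.* ε)    ≡⟨ ≡.cong (seq z n ℚ.+_) (half-sum ε) ⟩
      seq z n ℚ.+ ε                        ∎)
    (below x≤y (½ ℚ.* ε) (half-pos 0<ε)) (below y≤z (½ ℚ.* ε) (half-pos 0<ε))
    where open ℚ.≤-Reasoning

  +-mono-≤ : ∀ {x x′ y y′} → x ≤ x′ → y ≤ y′ → x + y ≤ x′ + y′
  +-mono-≤ {x} {x′} {y} {y′} x≤ y≤ = mk≤ λ ε 0<ε → ev-zip (λ n p q → begin-strict
      seq x n ℚ.+ seq y n                                      <⟨ ℚ.+-mono-< p q ⟩
      (seq x′ n ℚ.+ ½ ℚ.* ε) ℚ.+ (seq y′ n ℚ.+ ½ ℚ.* ε)        ≡⟨ Q.solve 3 (λ a b h → (a Q.:+ h) Q.:+ (b Q.:+ h) Q.:= (a Q.:+ b) Q.:+ (h Q.:+ h)) refl (seq x′ n) (seq y′ n) (½ ℚ.* ε) ⟩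
      (seq x′ n ℚ.+ seq y′ n) ℚ.+ (½ ℚ.* ε ℚ.+ ½ ℚ.* ε)        ≡⟨ ≡.cong ((seq x′ n ℚ.+ seq y′ n) ℚ.+_) (half-sum ε) ⟩
      (seq x′ n ℚ.+ seq y′ n) ℚ.+ ε                            ∎)
    (below x≤ (½ ℚ.* ε) (half-pos 0<ε)) (below y≤ (½ ℚ.* ε) (half-pos 0<ε))
    where open ℚ.≤-Reasoning

  *-nonNeg-≤ : ∀ {x y} → 0ℝ ≤ x → 0ℝ ≤ y → 0ℝ ≤ x * y
  *-nonNeg-≤ {x} {y} 0≤x 0≤y = mk≤ λ ε 0<ε →
      let (A , 0<A , x<A)  = bounded x
          (B , 0<B , y<B)  = bounded y
          (δ , 0<δ , eq)   = divide (A ℚ.+ B) ε (+-pos 0<A 0<B) 0<ε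
      in ev-zip (λ n (a , b) (p , q) → cases (seq x n) (seq y n) 0<A 0<B 0<δ eq a b p q)
           (ev-zip (λ _ → _,_) x<A y<B)
           (ev-zip (λ _ → _,_) (below 0≤x δ 0<δ) (below 0≤y δ 0<δ))
    where
    small : ∀ {p δ} → p ℚ.≤ 0ℚ → 0ℚ ℚ.< p ℚ.+ δ → ℚ.∣ p ∣ ℚ.< δ
    small {p} {δ} p≤0 0<p+δ = begin-strict
      ℚ.∣ p ∣             ≡⟨ ℚ.∣-p∣≡∣p∣ p ⟨
      ℚ.∣ ℚ.- p ∣         ≡⟨ ℚ.0≤p⇒∣p∣≡p (ℚ.neg-antimono-≤ p≤0) ⟩
      ℚ.- p               ≡⟨ ℚ.+-identityʳ (ℚ.- p) ⟨
      ℚ.- p ℚ.+ 0ℚ        <⟨ ℚ.+-monoʳ-< (ℚ.- p) 0<p+δ ⟩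
      ℚ.- p ℚ.+ (p ℚ.+ δ) ≡⟨ Q.solve 2 (λ p δ → Q.:- p Q.:+ (p Q.:+ δ) Q.:= δ) refl p δ ⟩
      δ                   ∎
      where open ℚ.≤-Reasoning

    above : ∀ r {ε} → ℚ.∣ r ∣ ℚ.< ε → 0ℚ ℚ.< r ℚ.+ ε
    above r {ε} r<ε = begin-strict
      0ℚ             ≡⟨ ℚ.+-inverseʳ r ⟨
      r ℚ.+ ℚ.- r    ≤⟨ ℚ.+-monoʳ-≤ r (-p≤∣p∣ r) ⟩
      r ℚ.+ ℚ.∣ r ∣  <⟨ ℚ.+-monoʳ-< r r<ε ⟩
      r ℚ.+ ε        ∎
      where open ℚ.≤-Reasoning

    cases : ∀ p q {A B δ ε} → 0ℚ ℚ.< A → 0ℚ ℚ.< B → 0ℚ ℚ.< δ → (A ℚ.+ B) ℚ.* δ ≡ ε →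
            ℚ.∣ p ∣ ℚ.< A → ℚ.∣ q ∣ ℚ.< B → 0ℚ ℚ.< p ℚ.+ δ → 0ℚ ℚ.< q ℚ.+ δ →
            0ℚ ℚ.< p ℚ.* q ℚ.+ ε
    cases p q {A} {B} {δ} {ε} 0<A 0<B 0<δ eq p<A q<B p+ q+
      with ℚ.≤-total 0ℚ p | ℚ.≤-total 0ℚ q
    ... | inj₁ 0≤p | inj₁ 0≤q = ℚ.+-mono-≤-< (*-nonNeg 0≤p 0≤q)
      (≡.subst (0ℚ ℚ.<_) eq (*-pos (+-pos 0<A 0<B) 0<δ))
    ... | inj₁ _ | inj₂ q≤0 = above (p ℚ.* q) (ℚ.<-trans (*-mono-abs {p} p<A (small q≤0 q+))
      (≡.subst (A ℚ.* δ ℚ.<_) (≡.trans (≡.sym (ℚ.*-distribʳ-+ δ A B)) eq)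
        (≡.subst (ℚ._< A ℚ.* δ ℚ.+ B ℚ.* δ) (ℚ.+-identityʳ (A ℚ.* δ))
          (ℚ.+-monoʳ-< (A ℚ.* δ) (*-pos 0<B 0<δ)))))
    ... | inj₂ p≤0 | _ = above (p ℚ.* q) (ℚ.<-trans
      (≡.subst (λ r → ℚ.∣ r ∣ ℚ.< B ℚ.* δ) (ℚ.*-comm q p) (*-mono-abs {q} q<B (small p≤0 p+)))
      (≡.subst (B ℚ.* δ ℚ.<_) (≡.trans (≡.sym (ℚ.*-distribʳ-+ δ A B)) eq)
        (≡.subst (ℚ._< A ℚ.* δ ℚ.+ B ℚ.* δ) (ℚ.+-identityˡ (B ℚ.* δ))
          (ℚ.+-monoˡ-< (B ℚ.* δ) (*-pos 0<A 0<δ)))))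

  abs-< : ∀ p b → p ℚ.< b → ℚ.- p ℚ.< b → ℚ.∣ p ∣ ℚ.< b
  abs-< p b p<b -p<b with ℚ.∣p∣≡p∨∣p∣≡-p p
  ... | inj₁ eq = ≡.subst (ℚ._< b) (≡.sym eq) p<b
  ... | inj₂ eq = ≡.subst (ℚ._< b) (≡.sym eq) -p<b

  ∣x∣≤ : ∀ {x y} → x ≤ y → - x ≤ y → ∣ x ∣ ≤ y
  ∣x∣≤ {x} {y} x≤y -x≤y = mk≤ λ ε 0<ε →
    ev-zip (λ n → abs-< (seq x n) (seq y n ℚ.+ ε)) (below x≤y ε 0<ε) (below -x≤y ε 0<ε)

  ∣∣-cong : ∀ {x y} → x ≃ y → ∣ x ∣ ≃ ∣ y ∣
  ∣∣-cong {x} {y} x≃y = mk≃ λ ε 0<ε →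
    ev-map (λ n → ℚ.≤-<-trans (dist-abs (seq x n) (seq y n))) (close x≃y ε 0<ε)

  ∣x+y∣≤ : ∀ x y → ∣ x + y ∣ ≤ ∣ x ∣ + ∣ y ∣
  ∣x+y∣≤ x y = ≤-pointwise λ n → ℚ.∣p+q∣≤∣p∣+∣q∣ (seq x n) (seq y n)

  ∣x*y∣ : ∀ x y → ∣ x * y ∣ ≃ ∣ x ∣ * ∣ y ∣
  ∣x*y∣ x y = ≡⇒≃ λ n → ℚ.∣p*q∣≡∣p∣*∣q∣ (seq x n) (seq y n)

  0≤∣x∣ : ∀ x → 0ℝ ≤ ∣ x ∣
  0≤∣x∣ x = ≤-pointwise λ n → ℚ.0≤∣p∣ (seq x n)

  <⇒≤ : ∀ {x y} → x < y → x ≤ y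
  <⇒≤ {x} {y} (mk< g 0<g x+g<y) = mk≤ λ ε 0<ε → ev-map (λ n lt → begin-strict
      seq x n          ≡⟨ ℚ.+-identityʳ (seq x n) ⟨
      seq x n ℚ.+ 0ℚ   <⟨ ℚ.+-mono-<-≤ (ℚ.<-trans (≡.subst (ℚ._< seq x n ℚ.+ g) (ℚ.+-identityʳ (seq x n)) (ℚ.+-monoʳ-< (seq x n) 0<g)) lt) (ℚ.<⇒≤ 0<ε) ⟩
      seq y n ℚ.+ ε    ∎) x+g<y
    where open ℚ.≤-Reasoning

  ofℚ-pos : ∀ {p} → 0ℚ ℚ.< p → 0ℝ < ofℚ p
  ofℚ-pos {p} 0<p = mk< (½ ℚ.* p) (half-pos 0<p) (always λ _ →
    ≡.subst₂ ℚ._<_ (≡.sym (ℚ.+-identityˡ (½ ℚ.* p))) (half-sum p)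
      (≡.subst (ℚ._< ½ ℚ.* p ℚ.+ ½ ℚ.* p) (ℚ.+-identityʳ (½ ℚ.* p))
        (ℚ.+-monoʳ-< (½ ℚ.* p) (half-pos 0<p))))

  rational-below : ∀ {ε} → 0ℝ < ε → ∃ λ η → 0ℚ ℚ.< η × (∀ {x} → x ≤ ofℚ η → x < ε)
  rational-below {ε} (mk< g 0<g 0+g<ε) = ½ ℚ.* g , half-pos 0<g , λ {x} x≤ →
      mk< (½ ℚ.* (½ ℚ.* g)) (half-pos (half-pos 0<g)) (ev-zip (λ n p q → begin-strict
        seq x n ℚ.+ h                    <⟨ ℚ.+-monoˡ-< h p ⟩
        (½ ℚ.* g ℚ.+ h) ℚ.+ h            ≡⟨ ℚ.+-assoc (½ ℚ.* g) h h ⟩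
        ½ ℚ.* g ℚ.+ (h ℚ.+ h)            ≡⟨ ≡.cong (½ ℚ.* g ℚ.+_) (half-sum (½ ℚ.* g)) ⟩
        ½ ℚ.* g ℚ.+ ½ ℚ.* g              ≡⟨ half-sum g ⟩
        g                                ≡⟨ ℚ.+-identityˡ g ⟨
        0ℚ ℚ.+ g                         <⟨ q ⟩
        seq ε n                          ∎)
      (below x≤ h (half-pos (half-pos 0<g))) 0+g<ε)
    where
    open ℚ.≤-Reasoning
    h : ℚ
    h = ½ ℚ.* (½ ℚ.* g)

ℝ-preorder : Preorder 0ℓ 0ℓ 0ℓ
ℝ-preorder = record
  { Carrier = ℝ ; _≈_ = _≃_ ; _≲_ = _≤_
  ; isPreorder = record
    { isEquivalence = record { refl = ≃-refl ; sym = ≃-sym ; trans = ≃-trans }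
    ; reflexive = ≃⇒≤ ; trans = ≤-trans } }

module ℝ-Reasoning = Relation.Binary.Reasoning.Preorder ℝ-preorder

abstract

  ≤-refl : ∀ {x} → x ≤ x
  ≤-refl = ≃⇒≤ ≃-refl

  ≤⇒0≤- : ∀ {x y} → x ≤ y → 0ℝ ≤ y - x
  ≤⇒0≤- {x} {y} x≤y = begin
    0ℝ     ≈⟨ R.solve 1 (λ x → R.con 0ℚ R.:= x R.:- x) ≃-refl x ⟩
    x - x  ≲⟨ +-mono-≤ x≤y ≤-refl ⟩
    y - x  ∎
    where open ℝ-Reasoning

  0≤-⇒≤ : ∀ {x y} → 0ℝ ≤ y - x → x ≤ y
  0≤-⇒≤ {x} {y} 0≤y-x = begin
    x            ≈⟨ R.solve 1 (λ x → x R.:= R.con 0ℚ R.:+ x) ≃-refl x ⟩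
    0ℝ + x       ≲⟨ +-mono-≤ 0≤y-x ≤-refl ⟩
    (y - x) + x  ≈⟨ R.solve 2 (λ x y → (y R.:- x) R.:+ x R.:= y) ≃-refl x y ⟩
    y            ∎
    where open ℝ-Reasoning

  neg-antimono-≤ : ∀ {x y} → x ≤ y → - y ≤ - x
  neg-antimono-≤ {x} {y} x≤y = begin
    - y            ≈⟨ R.solve 2 (λ x y → R.:- y R.:= x R.:+ (R.:- x R.:- y)) ≃-refl x y ⟩
    x + (- x - y)  ≲⟨ +-mono-≤ x≤y ≤-refl ⟩
    y + (- x - y)  ≈⟨ R.solve 2 (λ x y → y R.:+ (R.:- x R.:- y) R.:= R.:- x) ≃-refl x y ⟩
    - x            ∎
    where open ℝ-Reasoning

  *-monoʳ-≤ : ∀ {c x y} → 0ℝ ≤ c → x ≤ y → c * x ≤ c * y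
  *-monoʳ-≤ {c} {x} {y} 0≤c x≤y = 0≤-⇒≤ (begin
    0ℝ             ≲⟨ *-nonNeg-≤ 0≤c (≤⇒0≤- x≤y) ⟩
    c * (y - x)    ≈⟨ R.solve 3 (λ c x y → c R.:* (y R.:- x) R.:= c R.:* y R.:- c R.:* x) ≃-refl c x y ⟩
    c * y - c * x  ∎)
    where open ℝ-Reasoning

  *-mono-≤ : ∀ {x x′ y y′} → 0ℝ ≤ x → 0ℝ ≤ y′ → x ≤ x′ → y ≤ y′ → x * y ≤ x′ * y′
  *-mono-≤ {x} {x′} {y} {y′} 0≤x 0≤y′ x≤ y≤ = begin
    x * y    ≲⟨ *-monoʳ-≤ 0≤x y≤ ⟩
    x * y′   ≈⟨ R.solve 2 (λ a b → a R.:* b R.:= b R.:* a) ≃-refl x y′ ⟩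
    y′ * x   ≲⟨ *-monoʳ-≤ 0≤y′ x≤ ⟩
    y′ * x′  ≈⟨ R.solve 2 (λ a b → a R.:* b R.:= b R.:* a) ≃-refl y′ x′ ⟩
    x′ * y′  ∎
    where open ℝ-Reasoning

  0≤1 : 0ℝ ≤ 1ℝ
  0≤1 = ≤-pointwise λ _ → ℚ.<⇒≤ 0<1

  ^-nonNeg : ∀ {x} n → 0ℝ ≤ x → 0ℝ ≤ x ^ n
  ^-nonNeg zero    0≤x = 0≤1
  ^-nonNeg (suc n) 0≤x = *-nonNeg-≤ 0≤x (^-nonNeg n 0≤x)

  ^-mono-≤ : ∀ {x y} n → 0ℝ ≤ x → x ≤ y → x ^ n ≤ y ^ n
  ^-mono-≤ zero    0≤x x≤y = ≤-refl
  ^-mono-≤ (suc n) 0≤x x≤y =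
    *-mono-≤ 0≤x (^-nonNeg n (≤-trans 0≤x x≤y)) x≤y (^-mono-≤ n 0≤x x≤y)

  sum-mono-≤ : ∀ {n} {f g : Vector ℝ n} → (∀ i → f i ≤ g i) → sum f ≤ sum g
  sum-mono-≤ {zero}  f≤g = ≤-refl
  sum-mono-≤ {suc n} f≤g = +-mono-≤ (f≤g zero) (sum-mono-≤ (f≤g ∘ suc))

  sum-telescope : ∀ {n} (g : Vector ℝ (suc n)) →
                  ∑[ i < n ] (g (suc i) - g (inject₁ i)) ≃ g (fromℕ n) - g zero
  sum-telescope {zero}  g = R.solve 1 (λ x → R.con 0ℚ R.:= x R.:- x) ≃-refl (g zero)
  sum-telescope {suc n} g = ≃-trans (+-cong ≃-refl (sum-telescope (g ∘ suc)))
    (R.solve 3 (λ a b c → (b R.:- a) R.:+ (c R.:- b) R.:= c R.:- a) ≃-refl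
      (g zero) (g (suc zero)) (g (suc (fromℕ n))))

record TaggedPartition (a b : ℝ) (k : ℕ) : Set where
  field
    point     : Vector ℝ (suc k)
    tag       : Vector ℝ k
    first     : point zero ≃ a
    last      : point (fromℕ k) ≃ b
    point≤tag : ∀ i → point (inject₁ i) ≤ tag i
    tag≤point : ∀ i → tag i ≤ point (suc i)

  width : Vector ℝ k
  width i = point (suc i) - point (inject₁ i)

open TaggedPartition public

riemannSum : ∀ {a b k} → (ℝ → ℝ) → TaggedPartition a b k → ℝ
riemannSum {k = k} f P = ∑[ i < k ] (f (tag P i) * width P i)

-- Intended for a ≤ b; otherwise [a, b] has no tagged partitions.
HasIntegral : (a b : ℝ) → (ℝ → ℝ) → ℝ → Set
HasIntegral a b f I =
  ∀ ε → 0ℝ < ε → ∃ λ δ → 0ℝ < δ ×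
  (∀ {k} (P : TaggedPartition a b k) → (∀ i → width P i < δ) → ∣ riemannSum f P - I ∣ < ε)

Integrable : (a b : ℝ) → (ℝ → ℝ) → Set
Integrable a b f = ∃ (HasIntegral a b f)

∫ : (a b : ℝ) (f : ℝ → ℝ) → Integrable a b f → ℝ
∫ a b f = proj₁

-- A variant with rational tolerances and non-strict inequalities, used only to
-- establish integrability.
record HasIntegralℚ (a b : ℝ) (f : ℝ → ℝ) (I : ℝ) : Set where
  constructor mk∫
  field
    approx : ∀ ε → 0ℚ ℚ.< ε → ∃ λ δ → 0ℚ ℚ.< δ ×
             (∀ {k} (P : TaggedPartition a b k) → (∀ i → width P i ≤ ofℚ δ) →
              ∣ riemannSum f P - I ∣ ≤ ofℚ ε)

open HasIntegralℚ public

abstract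

  fromHasIntegralℚ : ∀ {a b f I} → HasIntegralℚ a b f I → HasIntegral a b f I
  fromHasIntegralℚ int ε 0<ε =
    let (η , 0<η , below-ε)  = rational-below 0<ε
        (δ , 0<δ , near)     = approx int η 0<η
    in ofℚ δ , ofℚ-pos 0<δ , λ P fine → below-ε (near P λ i → <⇒≤ (fine i))

  HasIntegralℚ-cong : ∀ {a b f g I} → (∀ t → f t ≃ g t) → HasIntegralℚ a b f I → HasIntegralℚ a b g I
  HasIntegralℚ-cong f≃g int = mk∫ λ ε 0<ε →
    let (δ , 0<δ , near) = approx int ε 0<ε
    in δ , 0<δ , λ P fine → ≤-trans
         (≃⇒≤ (∣∣-cong (+-cong (sum-cong-≋ λ i → *-cong (≃-sym (f≃g (tag P i))) ≃-refl) ≃-refl)))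
         (near P fine)

  ⊓-pos : ∀ {p q} → 0ℚ ℚ.< p → 0ℚ ℚ.< q → 0ℚ ℚ.< p ℚ.⊓ q
  ⊓-pos {p} {q} 0<p 0<q with ℚ.⊓-sel p q
  ... | inj₁ eq = ≡.subst (0ℚ ℚ.<_) (≡.sym eq) 0<p
  ... | inj₂ eq = ≡.subst (0ℚ ℚ.<_) (≡.sym eq) 0<q

  HasIntegralℚ-+ : ∀ {a b f g I J} → HasIntegralℚ a b f I → HasIntegralℚ a b g J →
                   HasIntegralℚ a b (λ t → f t + g t) (I + J)
  HasIntegralℚ-+ {a} {b} {f} {g} {I} {J} int-f int-g = mk∫ λ ε 0<ε →
    let (δ , 0<δ , near-f)   = approx int-f (½ ℚ.* ε) (half-pos 0<ε)
        (δ′ , 0<δ′ , near-g) = approx int-g (½ ℚ.* ε) (half-pos 0<ε)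
    in δ ℚ.⊓ δ′ , ⊓-pos 0<δ 0<δ′ , λ P fine → added ε P
         (near-f P λ i → ≤-trans (fine i) (≤-pointwise λ _ → ℚ.p⊓q≤p δ δ′))
         (near-g P λ i → ≤-trans (fine i) (≤-pointwise λ _ → ℚ.p⊓q≤q δ δ′))
    where
    open ℝ-Reasoning
    added : ∀ ε {k} (P : TaggedPartition a b k) →
            ∣ riemannSum f P - I ∣ ≤ ofℚ (½ ℚ.* ε) → ∣ riemannSum g P - J ∣ ≤ ofℚ (½ ℚ.* ε) →
            ∣ riemannSum (λ t → f t + g t) P - (I + J) ∣ ≤ ofℚ ε
    added ε P near-f near-g = begin
      ∣ riemannSum (λ t → f t + g t) P - (I + J) ∣
        ≈⟨ ∣∣-cong (+-cong (≃-trans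
             (sum-cong-≋ λ i → R.solve 3 (λ f g w → (f R.:+ g) R.:* w R.:= f R.:* w R.:+ g R.:* w) ≃-refl
               (f (tag P i)) (g (tag P i)) (width P i))
             (∑-distrib-+ (λ i → f (tag P i) * width P i) (λ i → g (tag P i) * width P i))) ≃-refl) ⟩
      ∣ (riemannSum f P + riemannSum g P) - (I + J) ∣
        ≈⟨ ∣∣-cong (R.solve 4 (λ s t i j → (s R.:+ t) R.:- (i R.:+ j) R.:= (s R.:- i) R.:+ (t R.:- j)) ≃-refl
             (riemannSum f P) (riemannSum g P) I J) ⟩
      ∣ (riemannSum f P - I) + (riemannSum g P - J) ∣
        ≲⟨ ∣x+y∣≤ (riemannSum f P - I) (riemannSum g P - J) ⟩
      ∣ riemannSum f P - I ∣ + ∣ riemannSum g P - J ∣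
        ≲⟨ +-mono-≤ near-f near-g ⟩
      ofℚ (½ ℚ.* ε) + ofℚ (½ ℚ.* ε)
        ≈⟨ ≡⇒≃ (λ _ → half-sum ε) ⟩
      ofℚ ε ∎

  rational-bound : ∀ x → ∃ λ B → 0ℚ ℚ.< B × ∣ x ∣ ≤ ofℚ B
  rational-bound x = let (B , 0<B , x<B) = bounded x in B , 0<B , mk≤ λ ε 0<ε → ev-map (λ n lt → ℚ.<-trans lt
    (≡.subst (ℚ._< B ℚ.+ ε) (ℚ.+-identityʳ B) (ℚ.+-monoʳ-< B 0<ε))) x<B

  HasIntegralℚ-* : ∀ {a b f I} c → HasIntegralℚ a b f I → HasIntegralℚ a b (λ t → c * f t) (c * I)
  HasIntegralℚ-* {a} {b} {f} {I} c int = mk∫ λ ε 0<ε →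
    let (B , 0<B , c≤B)   = rational-bound c
        (η , 0<η , Bη≡ε)  = divide B ε 0<B 0<ε
        (δ , 0<δ , near)  = approx int η 0<η
    in δ , 0<δ , λ P fine → scaled ε B η c≤B 0<η Bη≡ε P (near P fine)
    where
    open ℝ-Reasoning
    scaled : ∀ ε B η → ∣ c ∣ ≤ ofℚ B → 0ℚ ℚ.< η → B ℚ.* η ≡ ε → ∀ {k} (P : TaggedPartition a b k) →
             ∣ riemannSum f P - I ∣ ≤ ofℚ η → ∣ riemannSum (λ t → c * f t) P - c * I ∣ ≤ ofℚ ε
    scaled ε B η c≤B 0<η Bη≡ε P near = begin
      ∣ riemannSum (λ t → c * f t) P - c * I ∣
        ≈⟨ ∣∣-cong (+-cong (≃-trans
             (sum-cong-≋ λ i → R.solve 3 (λ c f w → (c R.:* f) R.:* w R.:= c R.:* (f R.:* w)) ≃-refl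
               c (f (tag P i)) (width P i))
             (≃-sym (*-distribˡ-sum c (λ i → f (tag P i) * width P i)))) ≃-refl) ⟩
      ∣ c * riemannSum f P - c * I ∣
        ≈⟨ ∣∣-cong (R.solve 3 (λ c s i → c R.:* s R.:- c R.:* i R.:= c R.:* (s R.:- i)) ≃-refl
             c (riemannSum f P) I) ⟩
      ∣ c * (riemannSum f P - I) ∣
        ≈⟨ ∣x*y∣ c (riemannSum f P - I) ⟩
      ∣ c ∣ * ∣ riemannSum f P - I ∣
        ≲⟨ *-mono-≤ (0≤∣x∣ c) (≤-pointwise λ _ → ℚ.<⇒≤ 0<η) c≤B near ⟩
      ofℚ B * ofℚ η
        ≈⟨ ≡⇒≃ (λ _ → Bη≡ε) ⟩
      ofℚ ε ∎

1+ℚ : ℕ → ℚ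
1+ℚ zero    = 1ℚ
1+ℚ (suc k) = 1ℚ ℚ.+ 1+ℚ k

abstract

  1+ℚ-pos : ∀ k → 0ℚ ℚ.< 1+ℚ k
  1+ℚ-pos zero    = 0<1
  1+ℚ-pos (suc k) = +-pos 0<1 (1+ℚ-pos k)

  ^-difference-lower : ∀ {p q} k → 0ℝ ≤ p → p ≤ q →
                       ofℚ (1+ℚ k) * (p ^ k * (q - p)) ≤ q ^ suc k - p ^ suc k
  ^-difference-lower {p} {q} zero 0≤p p≤q = ≃⇒≤
    (R.solve 2 (λ p q → R.con 1ℚ R.:* (R.con 1ℚ R.:* (q R.:- p)) R.:= q R.:* R.con 1ℚ R.:- p R.:* R.con 1ℚ) ≃-refl p q)
  ^-difference-lower {p} {q} (suc k) 0≤p p≤q = begin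
      ofℚ (1ℚ ℚ.+ 1+ℚ k) * (p * P * (q - p))
        ≈⟨ *-cong {y = p * P * (q - p)} (≡⇒≃ {y = 1ℝ + C} (λ _ → refl)) ≃-refl ⟩
      (1ℝ + C) * (p * P * (q - p))
        ≈⟨ R.solve 4 (λ c p q P → (R.con 1ℚ R.:+ c) R.:* (p R.:* P R.:* (q R.:- p)) R.:=
             p R.:* (c R.:* (P R.:* (q R.:- p))) R.:+ (q R.:- p) R.:* (p R.:* P)) ≃-refl C p q P ⟩
      p * (C * (P * (q - p))) + (q - p) * (p * P)
        ≲⟨ +-mono-≤ (*-monoʳ-≤ 0≤p (^-difference-lower k 0≤p p≤q))
                    (*-monoʳ-≤ (≤⇒0≤- p≤q) (^-mono-≤ (suc k) 0≤p p≤q)) ⟩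
      p * (q * Q - p * P) + (q - p) * (q * Q)
        ≈⟨ R.solve 4 (λ p q P Q → p R.:* (q R.:* Q R.:- p R.:* P) R.:+ (q R.:- p) R.:* (q R.:* Q) R.:=
             q R.:* (q R.:* Q) R.:- p R.:* (p R.:* P)) ≃-refl p q P Q ⟩
      q * (q * Q) - p * (p * P) ∎
    where
    open ℝ-Reasoning
    C P Q : ℝ
    C = ofℚ (1+ℚ k)
    P = p ^ k
    Q = q ^ k

  ^-difference-upper : ∀ {p q} k → 0ℝ ≤ p → p ≤ q →
                       q ^ suc k - p ^ suc k ≤ ofℚ (1+ℚ k) * (q ^ k * (q - p))
  ^-difference-upper {p} {q} zero 0≤p p≤q = ≃⇒≤
    (R.solve 2 (λ p q → q R.:* R.con 1ℚ R.:- p R.:* R.con 1ℚ R.:= R.con 1ℚ R.:* (R.con 1ℚ R.:* (q R.:- p))) ≃-refl p q)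
  ^-difference-upper {p} {q} (suc k) 0≤p p≤q = begin
      q * (q * Q) - p * (p * P)
        ≈⟨ R.solve 4 (λ p q P Q → q R.:* (q R.:* Q) R.:- p R.:* (p R.:* P) R.:=
             q R.:* (q R.:* Q R.:- p R.:* P) R.:+ (q R.:- p) R.:* (p R.:* P)) ≃-refl p q P Q ⟩
      q * (q * Q - p * P) + (q - p) * (p * P)
        ≲⟨ +-mono-≤ (*-monoʳ-≤ (≤-trans 0≤p p≤q) (^-difference-upper k 0≤p p≤q))
                    (*-monoʳ-≤ (≤⇒0≤- p≤q) (^-mono-≤ (suc k) 0≤p p≤q)) ⟩
      q * (C * (Q * (q - p))) + (q - p) * (q * Q)
        ≈⟨ R.solve 4 (λ c p q Q → q R.:* (c R.:* (Q R.:* (q R.:- p))) R.:+ (q R.:- p) R.:* (q R.:* Q) R.:=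
             (R.con 1ℚ R.:+ c) R.:* (q R.:* Q R.:* (q R.:- p))) ≃-refl C p q Q ⟩
      (1ℝ + C) * (q * Q * (q - p))
        ≈⟨ *-cong {y = q * Q * (q - p)} (≡⇒≃ {x = 1ℝ + C} (λ _ → refl)) ≃-refl ⟩
      ofℚ (1ℚ ℚ.+ 1+ℚ k) * (q * Q * (q - p)) ∎
    where
    open ℝ-Reasoning
    C P Q : ℝ
    C = ofℚ (1+ℚ k)
    P = p ^ k
    Q = q ^ k

  -- On a cell with endpoints p ≤ q and tag s, the term of the Riemann sum of
  -- (k + 1) tᵏ differs from qᵏ⁺¹ - pᵏ⁺¹ by at most (k + 1) (q - p) (qᵏ - pᵏ).
  cell-upper : ∀ {p s q} k → 0ℝ ≤ p → p ≤ s → s ≤ q →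
               ofℚ (1+ℚ k) * s ^ k * (q - p) - (q ^ suc k - p ^ suc k) ≤
               ofℚ (1+ℚ k) * ((q - p) * (q ^ k - p ^ k))
  cell-upper {p} {s} {q} k 0≤p p≤s s≤q = begin
      C * s ^ k * (q - p) - (q ^ suc k - p ^ suc k)
        ≈⟨ +-cong (R.solve 3 (λ c s w → c R.:* s R.:* w R.:= c R.:* w R.:* s) ≃-refl C (s ^ k) (q - p)) ≃-refl ⟩
      C * (q - p) * s ^ k - (q ^ suc k - p ^ suc k)
        ≲⟨ +-mono-≤ (*-monoʳ-≤ 0≤Cw (^-mono-≤ k (≤-trans 0≤p p≤s) s≤q))
                    (neg-antimono-≤ (^-difference-lower k 0≤p p≤q)) ⟩
      C * (q - p) * q ^ k - C * (p ^ k * (q - p))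
        ≈⟨ R.solve 4 (λ c w P Q → c R.:* w R.:* Q R.:- c R.:* (P R.:* w) R.:= c R.:* (w R.:* (Q R.:- P))) ≃-refl
             C (q - p) (p ^ k) (q ^ k) ⟩
      C * ((q - p) * (q ^ k - p ^ k)) ∎
    where
    open ℝ-Reasoning
    C : ℝ
    C = ofℚ (1+ℚ k)
    p≤q : p ≤ q
    p≤q = ≤-trans p≤s s≤q
    0≤Cw : 0ℝ ≤ C * (q - p)
    0≤Cw = *-nonNeg-≤ (≤-pointwise λ _ → ℚ.<⇒≤ (1+ℚ-pos k)) (≤⇒0≤- p≤q)

  cell-lower : ∀ {p s q} k → 0ℝ ≤ p → p ≤ s → s ≤ q →
               (q ^ suc k - p ^ suc k) - ofℚ (1+ℚ k) * s ^ k * (q - p) ≤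
               ofℚ (1+ℚ k) * ((q - p) * (q ^ k - p ^ k))
  cell-lower {p} {s} {q} k 0≤p p≤s s≤q = begin
      (q ^ suc k - p ^ suc k) - C * s ^ k * (q - p)
        ≈⟨ +-cong ≃-refl (-‿cong (R.solve 3 (λ c s w → c R.:* s R.:* w R.:= c R.:* w R.:* s) ≃-refl C (s ^ k) (q - p))) ⟩
      (q ^ suc k - p ^ suc k) - C * (q - p) * s ^ k
        ≲⟨ +-mono-≤ (^-difference-upper k 0≤p p≤q)
                    (neg-antimono-≤ (*-monoʳ-≤ 0≤Cw (^-mono-≤ k 0≤p p≤s))) ⟩
      C * (q ^ k * (q - p)) - C * (q - p) * p ^ k
        ≈⟨ R.solve 4 (λ c w P Q → c R.:* (Q R.:* w) R.:- c R.:* w R.:* P R.:= c R.:* (w R.:* (Q R.:- P))) ≃-refl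
             C (q - p) (p ^ k) (q ^ k) ⟩
      C * ((q - p) * (q ^ k - p ^ k)) ∎
    where
    open ℝ-Reasoning
    C : ℝ
    C = ofℚ (1+ℚ k)
    p≤q : p ≤ q
    p≤q = ≤-trans p≤s s≤q
    0≤Cw : 0ℝ ≤ C * (q - p)
    0≤Cw = *-nonNeg-≤ (≤-pointwise λ _ → ℚ.<⇒≤ (1+ℚ-pos k)) (≤⇒0≤- p≤q)

  increasing⇒nonNeg : ∀ {k} (u : Vector ℝ (suc k)) → 0ℝ ≤ u zero →
                      (∀ i → u (inject₁ i) ≤ u (suc i)) → ∀ i → 0ℝ ≤ u i
  increasing⇒nonNeg         u 0≤u₀ inc zero    = 0≤u₀
  increasing⇒nonNeg {suc k} u 0≤u₀ inc (suc i) =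
    increasing⇒nonNeg (u ∘ suc) (≤-trans 0≤u₀ (inc zero)) (inc ∘ suc) i

  ^-cong : ∀ {x y} k → x ≃ y → x ^ k ≃ y ^ k
  ^-cong zero    x≃y = ≃-refl
  ^-cong (suc k) x≃y = *-cong x≃y (^-cong k x≃y)

  1^k≃1 : ∀ k → 1ℝ ^ k ≃ 1ℝ
  1^k≃1 zero    = ≃-refl
  1^k≃1 (suc k) = ≃-trans (*-cong ≃-refl (1^k≃1 k)) (≡⇒≃ λ _ → ℚ.*-identityˡ 1ℚ)

  ^-derivative-integral : ∀ k → HasIntegralℚ 0ℝ 1ℝ (λ t → ofℚ (1+ℚ k) * t ^ k) 1ℝ
  ^-derivative-integral k = mk∫ λ ε 0<ε →
    let (δ , 0<δ , Cδ≡ε) = divide (1+ℚ k) ε (1+ℚ-pos k) 0<ε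
    in δ , 0<δ , near ε 0<ε δ Cδ≡ε
    where
    open ℝ-Reasoning
    C : ℝ
    C = ofℚ (1+ℚ k)

    0≤C : 0ℝ ≤ C
    0≤C = ≤-pointwise λ _ → ℚ.<⇒≤ (1+ℚ-pos k)

    near : ∀ ε → 0ℚ ℚ.< ε → ∀ δ → 1+ℚ k ℚ.* δ ≡ ε → ∀ {n} (P : TaggedPartition 0ℝ 1ℝ n) → (∀ i → width P i ≤ ofℚ δ) →
           ∣ riemannSum (λ t → C * t ^ k) P - 1ℝ ∣ ≤ ofℚ ε
    near ε 0<ε δ Cδ≡ε {n} P fine = ∣x∣≤ upper lower
      where
      S : ℝ
      S = riemannSum (λ t → C * t ^ k) P

      left right : Vector ℝ n
      left  i = point P (inject₁ i)
      right i = point P (suc i)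

      G : Vector ℝ n
      G i = right i ^ suc k - left i ^ suc k

      0≤left : ∀ i → 0ℝ ≤ left i
      0≤left i = increasing⇒nonNeg (point P) (≃⇒≤ (≃-sym (first P)))
        (λ j → ≤-trans (point≤tag P j) (tag≤point P j)) (inject₁ i)

      left≤right : ∀ i → left i ≤ right i
      left≤right i = ≤-trans (point≤tag P i) (tag≤point P i)

      sum-G : sum G ≃ 1ℝ
      sum-G = begin-equality
        sum G                                             ≈⟨ sum-telescope (λ i → point P i ^ suc k) ⟩
        point P (fromℕ n) ^ suc k - point P zero ^ suc k  ≈⟨ +-cong (≃-trans (^-cong (suc k) (last P)) (1^k≃1 (suc k)))
                                                               (-‿cong (*-cong (first P) ≃-refl)) ⟩
        1ℝ - 0ℝ * point P zero ^ k                        ≈⟨ R.solve 1 (λ x → R.con 1ℚ R.:- R.con 0ℚ R.:* x R.:= R.con 1ℚ) ≃-refl (point P zero ^ k) ⟩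
        1ℝ                                                ∎

      sum-difference : ∀ {m} (f g : Vector ℝ m) → sum f - sum g ≃ ∑[ i < m ] (f i - g i)
      sum-difference {zero}  f g = R.solve 0 (R.con 0ℚ R.:- R.con 0ℚ R.:= R.con 0ℚ) ≃-refl
      sum-difference {suc m} f g = ≃-trans
        (R.solve 4 (λ a b c d → (a R.:+ b) R.:- (c R.:+ d) R.:= (a R.:- c) R.:+ (b R.:- d)) ≃-refl
          (f zero) (sum (f ∘ suc)) (g zero) (sum (g ∘ suc)))
        (+-cong ≃-refl (sum-difference (f ∘ suc) (g ∘ suc)))

      error : Vector ℝ n
      error i = C * (width P i * (right i ^ k - left i ^ k))

      sum-error : sum error ≤ ofℚ ε
      sum-error = begin
        sum error
          ≲⟨ sum-mono-≤ (λ i → *-monoʳ-≤ 0≤C (*-mono-≤ (≤⇒0≤- (left≤right i))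
               (≤⇒0≤- (^-mono-≤ k (0≤left i) (left≤right i))) (fine i) ≤-refl)) ⟩
        ∑[ i < n ] (C * (ofℚ δ * (right i ^ k - left i ^ k)))
          ≈⟨ sum-cong-≋ (λ i → ≃-trans
               (R.solve 3 (λ c d x → c R.:* (d R.:* x) R.:= (c R.:* d) R.:* x) ≃-refl C (ofℚ δ) (right i ^ k - left i ^ k))
               (*-cong {y = right i ^ k - left i ^ k} (≡⇒≃ {x = C * ofℚ δ} {ofℚ ε} λ _ → Cδ≡ε) ≃-refl)) ⟩
        ∑[ i < n ] (ofℚ ε * (right i ^ k - left i ^ k))
          ≈⟨ *-distribˡ-sum (ofℚ ε) (λ i → right i ^ k - left i ^ k) ⟨
        ofℚ ε * (∑[ i < n ] (right i ^ k - left i ^ k))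
          ≈⟨ *-cong {x = ofℚ ε} ≃-refl (sum-telescope (λ i → point P i ^ k)) ⟩
        ofℚ ε * (point P (fromℕ n) ^ k - point P zero ^ k)
          ≲⟨ *-monoʳ-≤ (≤-pointwise λ _ → ℚ.<⇒≤ 0<ε) (+-mono-≤
               (≃⇒≤ (≃-trans (^-cong k (last P)) (1^k≃1 k)))
               (neg-antimono-≤ (^-nonNeg k (≃⇒≤ (≃-sym (first P)))))) ⟩
        ofℚ ε * (1ℝ - 0ℝ)
          ≈⟨ R.solve 1 (λ e → e R.:* (R.con 1ℚ R.:- R.con 0ℚ) R.:= e) ≃-refl (ofℚ ε) ⟩
        ofℚ ε ∎

      upper : S - 1ℝ ≤ ofℚ ε
      upper = begin
        S - 1ℝ     ≈⟨ +-cong {x = S} ≃-refl (-‿cong (≃-sym sum-G)) ⟩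
        S - sum G  ≈⟨ sum-difference (λ i → C * tag P i ^ k * width P i) G ⟩
        _          ≲⟨ sum-mono-≤ (λ i → cell-upper k (0≤left i) (point≤tag P i) (tag≤point P i)) ⟩
        sum error  ≲⟨ sum-error ⟩
        ofℚ ε      ∎

      lower : - (S - 1ℝ) ≤ ofℚ ε
      lower = begin
        - (S - 1ℝ) ≈⟨ R.solve 2 (λ s o → R.:- (s R.:- o) R.:= o R.:- s) ≃-refl S 1ℝ ⟩
        1ℝ - S     ≈⟨ +-cong {y = - S} (≃-sym sum-G) ≃-refl ⟩
        sum G - S  ≈⟨ sum-difference G (λ i → C * tag P i ^ k * width P i) ⟩
        _          ≲⟨ sum-mono-≤ (λ i → cell-lower k (0≤left i) (point≤tag P i) (tag≤point P i)) ⟩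
        sum error  ≲⟨ sum-error ⟩
        ofℚ ε      ∎

  ^-integral : ∀ k → ∃ (HasIntegralℚ 0ℝ 1ℝ (_^ k))
  ^-integral k =
    let (r , _ , Cr≡1) = divide (1+ℚ k) 1ℚ (1+ℚ-pos k) 0<1
    in ofℚ r * 1ℝ , HasIntegralℚ-cong (scaled r Cr≡1) (HasIntegralℚ-* (ofℚ r) (^-derivative-integral k))
    where
    open ℝ-Reasoning
    C : ℝ
    C = ofℚ (1+ℚ k)
    scaled : ∀ r → 1+ℚ k ℚ.* r ≡ 1ℚ → ∀ t → ofℚ r * (C * t ^ k) ≃ t ^ k
    scaled r Cr≡1 t = begin-equality
      ofℚ r * (C * t ^ k)  ≈⟨ R.solve 3 (λ r c x → r R.:* (c R.:* x) R.:= (c R.:* r) R.:* x) ≃-refl (ofℚ r) C (t ^ k) ⟩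
      C * ofℚ r * t ^ k    ≈⟨ *-cong {y = t ^ k} (≡⇒≃ {x = C * ofℚ r} {1ℝ} λ _ → Cr≡1) ≃-refl ⟩
      1ℝ * t ^ k           ≈⟨ R.solve 1 (λ x → R.con 1ℚ R.:* x R.:= x) ≃-refl (t ^ k) ⟩
      t ^ k                ∎

fallingFactorial : ℝ → ℕ → ℝ
fallingFactorial z zero    = 1ℝ
fallingFactorial z (suc n) = fallingFactorial z n * (z - ofℕ n)

binom : ℝ → ℕ → ℝ
binom z n = fallingFactorial z n /! n

abstract

  -- Polynomial functions are integrable: multiplication by an affine factor
  -- preserves integrability of all products with powers.
  affine-step : ∀ {f g : ℝ → ℝ} a b → (∀ t → g t ≃ a * t + b) →
                (∀ k → ∃ (HasIntegralℚ 0ℝ 1ℝ (λ t → t ^ k * f t))) →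
                ∀ k → ∃ (HasIntegralℚ 0ℝ 1ℝ (λ t → t ^ k * (f t * g t)))
  affine-step {f} {g} a b g≃ int k =
    _ , HasIntegralℚ-cong
      (λ t → ≃-trans
        (R.solve 5 (λ a b t T F → a R.:* ((t R.:* T) R.:* F) R.:+ b R.:* (T R.:* F) R.:=
          T R.:* (F R.:* (a R.:* t R.:+ b))) ≃-refl a b t (t ^ k) (f t))
        (*-cong {x = t ^ k} ≃-refl (*-cong {x = f t} ≃-refl (≃-sym (g≃ t)))))
      (HasIntegralℚ-+ (HasIntegralℚ-* a (proj₂ (int (suc k)))) (HasIntegralℚ-* b (proj₂ (int k))))

  fallingFactorial-integral : ∀ {h : ℝ → ℝ} a b → (∀ t → h t ≃ a * t + b) → ∀ n k →
    ∃ (HasIntegralℚ 0ℝ 1ℝ (λ t → t ^ k * fallingFactorial (h t) n))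
  fallingFactorial-integral a b h≃ zero k = _ , HasIntegralℚ-cong
    (λ t → R.solve 1 (λ T → T R.:= T R.:* R.con 1ℚ) ≃-refl (t ^ k)) (proj₂ (^-integral k))
  fallingFactorial-integral {h} a b h≃ (suc n) k = affine-step a (b - ofℕ n)
    (λ t → ≃-trans (+-cong {y = - ofℕ n} (h≃ t) ≃-refl)
      (R.solve 4 (λ a b t m → (a R.:* t R.:+ b) R.:- m R.:= a R.:* t R.:+ (b R.:- m)) ≃-refl a b t (ofℕ n)))
    (fallingFactorial-integral a b h≃ n) k

  binom-integrable : ∀ {h : ℝ → ℝ} a b → (∀ t → h t ≃ a * t + b) → ∀ n →
                     Integrable 0ℝ 1ℝ (λ t → binom (h t) n)
  binom-integrable {h} a b h≃ n = _ , fromHasIntegralℚ (HasIntegralℚ-cong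
    (λ t → R.solve 2 (λ r F → r R.:* (R.con 1ℚ R.:* F) R.:= F R.:* r) ≃-refl r (fallingFactorial (h t) n))
    (HasIntegralℚ-* r (proj₂ (fallingFactorial-integral a b h≃ n 0))))
    where
    r : ℝ
    r = ofℚ ((1ℤ ℚ./ n !) {{n ℕ.!≢0}})

  binom[t-x]-integrable : ∀ n x → Integrable 0ℝ 1ℝ (λ t → binom (t - x) n)
  binom[t-x]-integrable n x = binom-integrable 1ℝ (- x)
    (λ t → R.solve 2 (λ t x → t R.:- x R.:= R.con 1ℚ R.:* t R.:+ R.:- x) ≃-refl t x) n

  binom[x-t]-integrable : ∀ n x → Integrable 0ℝ 1ℝ (λ t → binom (x - t) n)
  binom[x-t]-integrable n x = binom-integrable (- 1ℝ) x
    (λ t → R.solve 2 (λ t x → x R.:- t R.:= (R.:- R.con 1ℚ) R.:* t R.:+ x) ≃-refl t x) n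

-- The subscripts ₁ and ₂ refer to the first and the second kind.
cauchyPoly₁ : ℕ → ℝ → ℝ
cauchyPoly₁ n x = ofℕ (n !) * ∫ 0ℝ 1ℝ (λ t → binom (t - x) n) (binom[t-x]-integrable n x)

cauchyPoly₂ : ℕ → ℝ → ℝ
cauchyPoly₂ n x = ofℕ (n !) * ∫ 0ℝ 1ℝ (λ t → binom (x - t) n) (binom[x-t]-integrable n x)

cauchyNumber₁ : ℕ → ℝ
cauchyNumber₁ n = cauchyPoly₁ n 0ℝ

cauchyNumber₂ : ℕ → ℝ
cauchyNumber₂ n = cauchyPoly₂ n 0ℝ

{-# OPTIONS --safe #-}
module Submission where

-- Both formulas are integrated forms of pointwise polynomial identities.  By the
-- upper negation rule binom z n = (-1)ⁿ binom (n - 1 - z) n they reduce to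
-- Vandermonde's convolution
--   binom (t - x) n = (-1)ⁿ binom (- t + (x + n - 1)) n
--                   = (-1)ⁿ ∑ₘ binom (- t) m binom (x + n - 1) (n - m),
--   binom (x - t) n = (-1)ⁿ binom (t + (n - 1 - x)) n
--                   = ∑ₘ (-1)ᵐ binom t m binom (x - m) (n - m).
-- Integrals are linear, and they are unique because [0, 1] has tagged partitions
-- of arbitrarily small mesh.

open import Defs
open import Algebra.Bundles using (CommutativeRing)
open import Data.Fin.Base using (zero; suc; toℕ; inject₁; fromℕ)
open import Data.Fin.Properties using (toℕ-inject₁; toℕ-fromℕ; toℕ≤pred[n])
open import Data.Integer.Base as ℤ using (+_; 1ℤ)
import Data.Integer.Properties as ℤ
open import Data.Nat.Base as ℕ using (ℕ; zero; suc; _∸_; _!; NonZero)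
import Data.Nat.Properties as ℕ
open import Data.Product.Base using (∃; _×_; _,_; proj₂)
open import Data.Rational.Base as ℚ using (mkℚ; 0ℚ; 1ℚ; ½)
import Data.Rational.Properties as ℚ
open import Data.Rational.Unnormalised.Base as ℚᵘ using (mkℚᵘ; *≡*; *≤*)
import Data.Rational.Unnormalised.Properties as ℚᵘ
open import Data.Vec.Functional using (Vector)
open import Function.Base using (_∘_)
open import Relation.Binary.PropositionalEquality as ≡ using (_≡_; refl)

open CommutativeRing ℝ-commutativeRing
  using (semiring; +-congˡ; +-congʳ; *-congˡ; *-congʳ; *-assoc; *-identityˡ; *-comm)
open import Algebra.Properties.Semiring.Exp semiring using (^-homo-*)

private
  module R = ℝ-Solver

-- Natural numbers and their reciprocals inside the reals

1/ℕ : (n : ℕ) .{{_ : NonZero n}} → ℝ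
1/ℕ n = ofℚ (1ℤ ℚ./ n)

-- The factor hidden in `x /! n`, named so that the ring solver can take it as an atom.
1/! : ℕ → ℝ
1/! n = 1/ℕ (n !) {{n ℕ.!≢0}}

abstract

  -- Normalisation blocks computation with `+ n ℚ./ 1`. This lemma and the next move such identities
  -- to unnormalised fractions, where cross-multiplication settles them.
  fromℚᵘ-homo-* : ∀ p q → ℚ.fromℚᵘ (p ℚᵘ.* q) ≡ ℚ.fromℚᵘ p ℚ.* ℚ.fromℚᵘ q
  fromℚᵘ-homo-* p q = ℚ.toℚᵘ-injective (begin
    ℚ.toℚᵘ (ℚ.fromℚᵘ (p ℚᵘ.* q))                       ≈⟨ ℚ.toℚᵘ-fromℚᵘ (p ℚᵘ.* q) ⟩
    p ℚᵘ.* q                                           ≈⟨ ℚᵘ.*-cong (ℚ.toℚᵘ-fromℚᵘ p) (ℚ.toℚᵘ-fromℚᵘ q) ⟨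
    ℚ.toℚᵘ (ℚ.fromℚᵘ p) ℚᵘ.* ℚ.toℚᵘ (ℚ.fromℚᵘ q)       ≈⟨ ℚ.toℚᵘ-homo-* (ℚ.fromℚᵘ p) (ℚ.fromℚᵘ q) ⟨
    ℚ.toℚᵘ (ℚ.fromℚᵘ p ℚ.* ℚ.fromℚᵘ q)                 ∎)
    where open ℚᵘ.≃-Reasoning

  fromℚᵘ-homo-+ : ∀ p q → ℚ.fromℚᵘ (p ℚᵘ.+ q) ≡ ℚ.fromℚᵘ p ℚ.+ ℚ.fromℚᵘ q
  fromℚᵘ-homo-+ p q = ℚ.toℚᵘ-injective (begin
    ℚ.toℚᵘ (ℚ.fromℚᵘ (p ℚᵘ.+ q))                       ≈⟨ ℚ.toℚᵘ-fromℚᵘ (p ℚᵘ.+ q) ⟩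
    p ℚᵘ.+ q                                           ≈⟨ ℚᵘ.+-cong (ℚ.toℚᵘ-fromℚᵘ p) (ℚ.toℚᵘ-fromℚᵘ q) ⟨
    ℚ.toℚᵘ (ℚ.fromℚᵘ p) ℚᵘ.+ ℚ.toℚᵘ (ℚ.fromℚᵘ q)       ≈⟨ ℚ.toℚᵘ-homo-+ (ℚ.fromℚᵘ p) (ℚ.fromℚᵘ q) ⟨
    ℚ.toℚᵘ (ℚ.fromℚᵘ p ℚ.+ ℚ.fromℚᵘ q)                 ∎)
    where open ℚᵘ.≃-Reasoning

  ofℕ-+ : ∀ m n → ofℕ (m ℕ.+ n) ≃ ofℕ m + ofℕ n
  ofℕ-+ m n = ≡⇒≃ λ _ → ≡.trans
    (ℚ.fromℚᵘ-cong {mkℚᵘ (+ (m ℕ.+ n)) 0} {mkℚᵘ (+ m) 0 ℚᵘ.+ mkℚᵘ (+ n) 0}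
      (*≡* (≡.cong (ℤ._* + 1) (≡.sym (≡.cong₂ ℤ._+_ (ℤ.*-identityʳ (+ m)) (ℤ.*-identityʳ (+ n)))))))
    (fromℚᵘ-homo-+ (mkℚᵘ (+ m) 0) (mkℚᵘ (+ n) 0))

  ofℕ-* : ∀ m n → ofℕ (m ℕ.* n) ≃ ofℕ m * ofℕ n
  ofℕ-* m n = ≡⇒≃ λ _ → ≡.trans
    (ℚ.fromℚᵘ-cong {mkℚᵘ (+ (m ℕ.* n)) 0} {mkℚᵘ (+ m) 0 ℚᵘ.* mkℚᵘ (+ n) 0}
      (*≡* (≡.cong (ℤ._* + 1) (ℤ.pos-* m n))))
    (fromℚᵘ-homo-* (mkℚᵘ (+ m) 0) (mkℚᵘ (+ n) 0))

  ofℕ-suc : ∀ n → ofℕ (suc n) ≃ 1ℝ + ofℕ n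
  ofℕ-suc n = ofℕ-+ 1 n

  ofℕ-inverse : ∀ n .{{_ : NonZero n}} → ofℕ n * 1/ℕ n ≃ 1ℝ
  ofℕ-inverse n@(suc k) = ≡⇒≃ λ _ → ≡.trans
    (≡.sym (fromℚᵘ-homo-* (mkℚᵘ (+ n) 0) (mkℚᵘ 1ℤ k)))
    (ℚ.fromℚᵘ-cong {mkℚᵘ (+ n) 0 ℚᵘ.* mkℚᵘ 1ℤ k} {mkℚᵘ 1ℤ 0}
      -- Cross-multiplied: `n * 1 * 1` against `1 * (1 * n)`, the latter computing to `(n + 0) + 0`.
      (*≡* (≡.cong +_ (≡.trans (ℕ.*-identityʳ (n ℕ.* 1)) (≡.trans (ℕ.*-comm n 1)
        (≡.cong (ℕ._+ 0) (≡.sym (ℕ.+-identityʳ n))))))))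

  ofℕ-cancelˡ : ∀ n .{{_ : NonZero n}} {x y} → ofℕ n * x ≃ ofℕ n * y → x ≃ y
  ofℕ-cancelˡ n {x} {y} nx≃ny = ≃-trans (≃-sym (undo x)) (≃-trans (*-congˡ {1/ℕ n} nx≃ny) (undo y))
    where
    undo : ∀ z → 1/ℕ n * (ofℕ n * z) ≃ z
    undo z = ≃-trans
      (R.solve 3 (λ r c z → r R.:* (c R.:* z) R.:= (c R.:* r) R.:* z) ≃-refl (1/ℕ n) (ofℕ n) z)
      (≃-trans (*-congʳ {z} (ofℕ-inverse n)) (*-identityˡ z))

  !*x/!≃x : ∀ n x → ofℕ (n !) * x /! n ≃ x
  !*x/!≃x n x = ≃-trans
    (R.solve 3 (λ c x r → c R.:* x R.:* r R.:= (c R.:* r) R.:* x) ≃-refl (ofℕ (n !)) x (1/! n))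
    (≃-trans (*-congʳ {x} (ofℕ-inverse (n !) {{n ℕ.!≢0}})) (*-identityˡ x))

  -- Multiplied by `n !`, both sides become `x`, because `suc n !` is `suc n * n !`.
  /!-suc : ∀ n x → ofℕ (suc n) * (x /! suc n) ≃ x /! n
  /!-suc n x = ofℕ-cancelˡ (n !) {{n ℕ.!≢0}} (begin-equality
    ofℕ (n !) * (ofℕ (suc n) * (x /! suc n))
      ≈⟨ R.solve 4 (λ f c x r → f R.:* (c R.:* (x R.:* r)) R.:= (c R.:* f) R.:* x R.:* r) ≃-refl
           (ofℕ (n !)) (ofℕ (suc n)) x (1/! (suc n)) ⟩
    ofℕ (suc n) * ofℕ (n !) * x /! suc n
      ≈⟨ *-congʳ (*-congʳ (ofℕ-* (suc n) (n !))) ⟨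
    ofℕ (suc n !) * x /! suc n
      ≈⟨ !*x/!≃x (suc n) x ⟩
    x
      ≈⟨ !*x/!≃x n x ⟨
    ofℕ (n !) * x /! n
      ≈⟨ *-assoc (ofℕ (n !)) x (1/! n) ⟩
    ofℕ (n !) * (x /! n) ∎)
    where open ℝ-Reasoning

-- Binomial coefficients

abstract

  fallingFactorial-cong : ∀ {y z} n → y ≃ z → fallingFactorial y n ≃ fallingFactorial z n
  fallingFactorial-cong zero    y≃z = ≃-refl
  fallingFactorial-cong (suc n) y≃z = *-cong (fallingFactorial-cong n y≃z) (+-congʳ y≃z)

  binom-cong : ∀ {y z} n → y ≃ z → binom y n ≃ binom z n
  binom-cong n y≃z = *-congʳ (fallingFactorial-cong n y≃z)

  -- Splits off the first factor; the definition splits off the last.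
  fallingFactorial-suc : ∀ z n → fallingFactorial z (suc n) ≃ z * fallingFactorial (z - 1ℝ) n
  fallingFactorial-suc z zero =
    R.solve 1 (λ z → R.con 1ℚ R.:* (z R.:- R.con 0ℚ) R.:= z R.:* R.con 1ℚ) ≃-refl z
  fallingFactorial-suc z (suc n) = begin-equality
    fallingFactorial z (suc n) * (z - ofℕ (suc n))
      ≈⟨ *-cong (fallingFactorial-suc z n) (+-congˡ (-‿cong (ofℕ-suc n))) ⟩
    z * F * (z - (1ℝ + ofℕ n))
      ≈⟨ R.solve 3 (λ z F m → z R.:* F R.:* (z R.:- (R.con 1ℚ R.:+ m)) R.:=
           z R.:* (F R.:* (z R.:- R.con 1ℚ R.:- m))) ≃-refl z F (ofℕ n) ⟩
    z * (F * (z - 1ℝ - ofℕ n)) ∎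
    where
    open ℝ-Reasoning
    F : ℝ
    F = fallingFactorial (z - 1ℝ) n

  -- Negating every factor reverses the product: the last factor `z - n` turns into `n - z`, the
  -- first factor of the new falling factorial, which `fallingFactorial-suc` absorbs.
  fallingFactorial-negation : ∀ z n →
    fallingFactorial z n ≃ (- 1ℝ) ^ n * fallingFactorial (ofℕ n - 1ℝ - z) n
  fallingFactorial-negation z zero    = ≃-sym (*-identityˡ 1ℝ)
  fallingFactorial-negation z (suc n) = begin-equality
    fallingFactorial z n * (z - ofℕ n)
      ≈⟨ *-congʳ (fallingFactorial-negation z n) ⟩
    S * F * (z - ofℕ n)
      ≈⟨ R.solve 4 (λ S F z m → S R.:* F R.:* (z R.:- m) R.:=
           (R.:- R.con 1ℚ) R.:* S R.:* ((m R.:- z) R.:* F)) ≃-refl S F z (ofℕ n) ⟩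
    - 1ℝ * S * ((ofℕ n - z) * F)
      ≈⟨ *-congˡ (*-congˡ (fallingFactorial-cong n
           (R.solve 2 (λ z m → m R.:- R.con 1ℚ R.:- z R.:= m R.:- z R.:- R.con 1ℚ) ≃-refl z (ofℕ n)))) ⟩
    - 1ℝ * S * ((ofℕ n - z) * fallingFactorial (ofℕ n - z - 1ℝ) n)
      ≈⟨ *-congˡ (fallingFactorial-suc (ofℕ n - z) n) ⟨
    - 1ℝ * S * fallingFactorial (ofℕ n - z) (suc n)
      ≈⟨ *-congˡ (fallingFactorial-cong (suc n) (≃-trans
           (R.solve 2 (λ z m → m R.:- z R.:= (R.con 1ℚ R.:+ m) R.:- R.con 1ℚ R.:- z) ≃-refl z (ofℕ n))
           (+-congʳ (+-congʳ (≃-sym (ofℕ-suc n)))))) ⟩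
    - 1ℝ * S * fallingFactorial (ofℕ (suc n) - 1ℝ - z) (suc n) ∎
    where
    open ℝ-Reasoning
    S F : ℝ
    S = (- 1ℝ) ^ n
    F = fallingFactorial (ofℕ n - 1ℝ - z) n

  binom-negation : ∀ z n → binom z n ≃ (- 1ℝ) ^ n * binom (ofℕ n - 1ℝ - z) n
  binom-negation z n = ≃-trans (*-congʳ (fallingFactorial-negation z n)) (*-assoc _ _ _)

  binom-zero : ∀ z → binom z 0 ≃ 1ℝ
  binom-zero z = *-identityˡ 1ℝ

  -- Coefficientwise, the differential equation `(1 + X) F′ = z F` of the binomial series
  -- `F = (1 + X)ᶻ`.
  binom-suc : ∀ z n → ofℕ (suc n) * binom z (suc n) ≃ (z - ofℕ n) * binom z n
  binom-suc z n = ≃-trans (/!-suc n (fallingFactorial z (suc n)))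
    (R.solve 3 (λ F d r → F R.:* d R.:* r R.:= d R.:* (F R.:* r)) ≃-refl
      (fallingFactorial z n) (z - ofℕ n) (1/! n))

-- Products of formal power series and Vandermonde's convolution

infixl 7 _⋆_

-- The Cauchy product of coefficient sequences; `∸` never truncates here, as the index is at most
-- `n`.
_⋆_ : (ℕ → ℝ) → (ℕ → ℝ) → ℕ → ℝ
(f ⋆ g) n = ∑[ m ≤ n ] (f (toℕ m) * g (n ∸ toℕ m))

-- The derivative of the formal power series with coefficients f.
∂ : (ℕ → ℝ) → ℕ → ℝ
∂ f n = ofℕ (suc n) * f (suc n)

abstract

  ⋆-congʳ : ∀ {f f′} g n → (∀ m → f m ≃ f′ m) → (f ⋆ g) n ≃ (f′ ⋆ g) n
  ⋆-congʳ g n f≃f′ = sum-cong-≋ {suc n} λ m → *-congʳ {g (n ∸ toℕ m)} (f≃f′ (toℕ m))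

  ⋆-distribʳ-+ : ∀ f f′ g n → ((λ m → f m + f′ m) ⋆ g) n ≃ (f ⋆ g) n + (f′ ⋆ g) n
  ⋆-distribʳ-+ f f′ g n = ≃-trans
    (sum-cong-≋ {suc n} λ m → R.solve 3 (λ a b c → (a R.:+ b) R.:* c R.:= a R.:* c R.:+ b R.:* c) ≃-refl
      (f (toℕ m)) (f′ (toℕ m)) (g (n ∸ toℕ m)))
    (∑-distrib-+ {suc n} (λ m → f (toℕ m) * g (n ∸ toℕ m)) (λ m → f′ (toℕ m) * g (n ∸ toℕ m)))

  -- With `f = f 0 + X f₁`, this is `f′ = f₁ + X f₁′` read off at degree `suc n`.
  ∂-suc : ∀ f n → ∂ f (suc n) ≃ ∂ (f ∘ suc) n + f (suc (suc n))
  ∂-suc f n = ≃-trans (*-congʳ (ofℕ-suc (suc n)))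
    (R.solve 2 (λ c x → (R.con 1ℚ R.:+ c) R.:* x R.:= c R.:* x R.:+ x) ≃-refl (ofℕ (suc n)) (f (suc (suc n))))

  -- Induction on the degree with `f` varying: the sum unfolds as `f ⋆ g = f 0 g + X (f₁ ⋆ g)`, so
  -- the product rule for `f₁` in degree `n` gives the one for `f` in degree `suc n`.
  leibniz : ∀ f g n → ∂ (f ⋆ g) n ≃ (∂ f ⋆ g) n + (f ⋆ ∂ g) n
  leibniz f g zero =
    R.solve 4 (λ a b c d → R.con 1ℚ R.:* (a R.:* d R.:+ (b R.:* c R.:+ R.con 0ℚ)) R.:=
      (R.con 1ℚ R.:* b R.:* c R.:+ R.con 0ℚ) R.:+ (a R.:* (R.con 1ℚ R.:* d) R.:+ R.con 0ℚ)) ≃-refl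
      (f 0) (f 1) (g 0) (g 1)
  leibniz f g (suc n) = begin-equality
    ofℕ (2 ℕ.+ n) * (f 0 * g (2 ℕ.+ n) + (f₁ ⋆ g) (suc n))
      ≈⟨ R.solve 4 (λ c a d X → c R.:* (a R.:* d R.:+ X) R.:= a R.:* (c R.:* d) R.:+ c R.:* X) ≃-refl
           (ofℕ (2 ℕ.+ n)) (f 0) (g (2 ℕ.+ n)) ((f₁ ⋆ g) (suc n)) ⟩
    f 0 * ∂ g (suc n) + ofℕ (2 ℕ.+ n) * (f₁ ⋆ g) (suc n)
      -- The sequence shifting f₁ ⋆ g by one lets ∂-suc peel one copy of (f₁ ⋆ g) (suc n) off (2 + n) copies.
      ≈⟨ +-congˡ (≃-trans (∂-suc (λ { zero → 0ℝ ; (suc m) → (f₁ ⋆ g) m }) n) (+-congʳ (leibniz f₁ g n))) ⟩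
    f 0 * ∂ g (suc n) + ((∂ f₁ ⋆ g) n + (f₁ ⋆ ∂ g) n + (f 1 * g (suc n) + (f₂ ⋆ g) n))
      -- The summands `a` and `c` form `(f ⋆ ∂ g) (suc n)` by definition; `1ℝ * d` is the leading
      -- term of `∂ f ⋆ g`, with `1ℝ` for `ofℕ 1`.
      ≈⟨ R.solve 5 (λ a b c d e → a R.:+ (b R.:+ c R.:+ (d R.:+ e)) R.:=
           (R.con 1ℚ R.:* d R.:+ (b R.:+ e)) R.:+ (a R.:+ c)) ≃-refl
           (f 0 * ∂ g (suc n)) ((∂ f₁ ⋆ g) n) ((f₁ ⋆ ∂ g) n) (f 1 * g (suc n)) ((f₂ ⋆ g) n) ⟩
    1ℝ * (f 1 * g (suc n)) + ((∂ f₁ ⋆ g) n + (f₂ ⋆ g) n) + (f ⋆ ∂ g) (suc n)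
      ≈⟨ +-congʳ (+-cong (≃-sym (*-assoc 1ℝ (f 1) (g (suc n))))
           (≃-trans (≃-sym (⋆-distribʳ-+ (∂ f₁) f₂ g n)) (⋆-congʳ g n (λ m → ≃-sym (∂-suc f m))))) ⟩
    (∂ f ⋆ g) (suc n) + (f ⋆ ∂ g) (suc n) ∎
    where
    open ℝ-Reasoning
    f₁ f₂ : ℕ → ℝ
    f₁ = f ∘ suc
    f₂ = f₁ ∘ suc

  -- Induction through the recurrence `binom-suc`: the factor `a + b - n` distributes over the
  -- convolution so as to differentiate one binomial or the other, and `leibniz` collects the two
  -- sums.
  vandermonde : ∀ a b n → binom (a + b) n ≃ (binom a ⋆ binom b) n
  vandermonde a b zero = begin-equality
    binom (a + b) 0              ≈⟨ binom-zero (a + b) ⟩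
    1ℝ                           ≈⟨ R.solve 0 (R.con 1ℚ R.:= R.con 1ℚ R.:* R.con 1ℚ R.:+ R.con 0ℚ) ≃-refl ⟩
    1ℝ * 1ℝ + 0ℝ                 ≈⟨ +-congʳ (*-cong (binom-zero a) (binom-zero b)) ⟨
    binom a 0 * binom b 0 + 0ℝ   ∎
    where open ℝ-Reasoning
  vandermonde a b (suc n) = ofℕ-cancelˡ (suc n) (begin-equality
    ofℕ (suc n) * binom (a + b) (suc n)
      ≈⟨ binom-suc (a + b) n ⟩
    (a + b - ofℕ n) * binom (a + b) n
      ≈⟨ *-congˡ (vandermonde a b n) ⟩
    (a + b - ofℕ n) * (binom a ⋆ binom b) n
      ≈⟨ *-distribˡ-sum {suc n} (a + b - ofℕ n) (λ m → binom a (toℕ m) * binom b (n ∸ toℕ m)) ⟩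
    ∑[ m ≤ n ] ((a + b - ofℕ n) * (binom a (toℕ m) * binom b (n ∸ toℕ m)))
      ≈⟨ sum-cong-≋ {suc n} (λ m → split (toℕ≤pred[n] m)) ⟩
    ∑[ m ≤ n ] (∂ (binom a) (toℕ m) * binom b (n ∸ toℕ m) + binom a (toℕ m) * ∂ (binom b) (n ∸ toℕ m))
      ≈⟨ ∑-distrib-+ {suc n} (λ m → ∂ (binom a) (toℕ m) * binom b (n ∸ toℕ m))
           (λ m → binom a (toℕ m) * ∂ (binom b) (n ∸ toℕ m)) ⟩
    (∂ (binom a) ⋆ binom b) n + (binom a ⋆ ∂ (binom b)) n
      ≈⟨ leibniz (binom a) (binom b) n ⟨
    ofℕ (suc n) * (binom a ⋆ binom b) (suc n) ∎)
    where
    open ℝ-Reasoning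
    -- Uses `a + b - n = (a - m) + (b - (n - m))`, where `m ≤ n` makes `n ∸ m` a true difference.
    split : ∀ {m} → m ℕ.≤ n → (a + b - ofℕ n) * (binom a m * binom b (n ∸ m)) ≃
                    ∂ (binom a) m * binom b (n ∸ m) + binom a m * ∂ (binom b) (n ∸ m)
    split {m} m≤n = begin-equality
      (a + b - ofℕ n) * (A * B)
        ≈⟨ *-congʳ (+-congˡ (-‿cong (≃-trans (≡⇒≃ λ _ → ≡.cong (λ k → + k ℚ./ 1) (≡.sym (ℕ.m+[n∸m]≡n m≤n)))
             (ofℕ-+ m (n ∸ m))))) ⟩
      (a + b - (ofℕ m + ofℕ (n ∸ m))) * (A * B)
        ≈⟨ R.solve 6 (λ a b m k A B → (a R.:+ b R.:- (m R.:+ k)) R.:* (A R.:* B) R.:=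
             (a R.:- m) R.:* A R.:* B R.:+ A R.:* ((b R.:- k) R.:* B)) ≃-refl a b (ofℕ m) (ofℕ (n ∸ m)) A B ⟩
      (a - ofℕ m) * A * B + A * ((b - ofℕ (n ∸ m)) * B)
        ≈⟨ +-cong (*-congʳ (binom-suc a m)) (*-congˡ (binom-suc b (n ∸ m))) ⟨
      ∂ (binom a) m * B + A * ∂ (binom b) (n ∸ m) ∎
      where
      A B : ℝ
      A = binom a m
      B = binom b (n ∸ m)

-- Integrals

abstract

  -- The value of `∫` carries only a `HasIntegral` proof, whereas linearity is stated for
  -- `HasIntegralℚ`. A rational mesh bound below the real one bridges the gap.
  toHasIntegralℚ : ∀ {a b f I} → HasIntegral a b f I → HasIntegralℚ a b f I
  toHasIntegralℚ int = mk∫ λ ε 0<ε →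
    let (δ , 0<δ , near)      = int (ofℚ ε) (ofℚ-pos 0<ε)
        (η , 0<η , below-δ)   = rational-below 0<δ
    in η , 0<η , λ P fine → <⇒≤ (near P λ i → below-δ (fine i))

  HasIntegralℚ-0 : ∀ {a b} → HasIntegralℚ a b (λ _ → 0ℝ) 0ℝ
  -- Any mesh bound serves, since every Riemann sum of zero is zero; `1ℚ` is arbitrary.
  HasIntegralℚ-0 = mk∫ λ ε 0<ε → 1ℚ , 0<1 , λ P _ → begin
      ∣ riemannSum (λ _ → 0ℝ) P - 0ℝ ∣  ≈⟨ ∣∣-cong (+-congʳ (*-distribˡ-sum 0ℝ (width P))) ⟨
      ∣ 0ℝ * sum (width P) - 0ℝ ∣       ≈⟨ ∣∣-cong (R.solve 1 (λ x → R.con 0ℚ R.:* x R.:- R.con 0ℚ R.:= R.con 0ℚ) ≃-refl (sum (width P))) ⟩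
      ∣ 0ℝ ∣                            ≲⟨ ≤-pointwise (λ _ → ℚ.<⇒≤ 0<ε) ⟩
      ofℚ ε                             ∎
    where open ℝ-Reasoning

  HasIntegralℚ-sum : ∀ {a b n} {f : Vector (ℝ → ℝ) n} {I : Vector ℝ n} →
    (∀ i → HasIntegralℚ a b (f i) (I i)) → HasIntegralℚ a b (λ t → ∑[ i < n ] f i t) (sum I)
  HasIntegralℚ-sum {n = zero}  int = HasIntegralℚ-0
  HasIntegralℚ-sum {n = suc n} int = HasIntegralℚ-+ (int zero) (HasIntegralℚ-sum (int ∘ suc))

  -- The Archimedean property: a positive fraction has numerator at least 1, so the reciprocal of
  -- its own denominator lies below it.
  1/denominator≤ : ∀ {δ} → 0ℚ ℚ.< δ → ∃ λ k → 1ℤ ℚ./ suc k ℚ.≤ δ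
  1/denominator≤ {mkℚ (+ zero) d c}     0<δ with ℤ.+<+ () ← ℚ.drop-*<* 0<δ
  1/denominator≤ {mkℚ ℤ.-[1+ n ] d c}  0<δ with () ← ℚ.drop-*<* 0<δ
  1/denominator≤ {mkℚ (+ suc n) d c}    _ = d , ℚ.toℚᵘ-cancel-≤
    (ℚᵘ.≤-respˡ-≃ (ℚᵘ.≃-sym (ℚ.toℚᵘ-fromℚᵘ (mkℚᵘ 1ℤ d)))
      (*≤* (ℤ.*-monoʳ-≤-nonNeg (+ suc d) (ℤ.+≤+ (ℕ.s≤s (ℕ.z≤n {n}))))))

  uniformPartition : ∀ k → ∃ λ (P : TaggedPartition 0ℝ 1ℝ (suc k)) → ∀ i → width P i ≃ 1/ℕ (suc k)
  uniformPartition k = P , step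
    where
    w : ℝ
    w = 1/ℕ (suc k)

    grid : Vector ℝ (2 ℕ.+ k)
    grid i = ofℕ (toℕ i) * w

    step : ∀ i → grid (suc i) - grid (inject₁ i) ≃ w
    step i rewrite toℕ-inject₁ i = ≃-trans (+-congʳ (*-congʳ (ofℕ-suc (toℕ i))))
      (R.solve 2 (λ c w → (R.con 1ℚ R.:+ c) R.:* w R.:- c R.:* w R.:= w) ≃-refl (ofℕ (toℕ i)) w)

    grid-fromℕ : grid (fromℕ (suc k)) ≃ 1ℝ
    grid-fromℕ rewrite toℕ-fromℕ k = ofℕ-inverse (suc k)

    P : TaggedPartition 0ℝ 1ℝ (suc k)
    P .point = grid
    -- Left endpoints as tags make one tag condition reflexivity and the other positivity of the
    -- step.
    P .tag   = grid ∘ inject₁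
    P .first = R.solve 1 (λ w → R.con 0ℚ R.:* w R.:= R.con 0ℚ) ≃-refl w
    P .last  = grid-fromℕ
    P .point≤tag i = ≤-refl
    P .tag≤point i = 0≤-⇒≤ (≤-trans
      (≤-pointwise λ _ → ℚ.<⇒≤ (ℚ.positive⁻¹ (1ℤ ℚ./ suc k) {{ℚ.normalize-pos 1 (suc k)}}))
      (≃⇒≤ (≃-sym (step i))))

  finePartition : ∀ {δ} → 0ℚ ℚ.< δ →
    ∃ λ k → ∃ λ (P : TaggedPartition 0ℝ 1ℝ k) → ∀ i → width P i ≤ ofℚ δ
  finePartition 0<δ =
    let (k , 1/k≤δ)    = 1/denominator≤ 0<δ
        (P , width≃w)  = uniformPartition k
    in suc k , P , λ i → ≤-trans (≃⇒≤ (width≃w i)) (≤-pointwise λ _ → 1/k≤δ)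

  ∣x-y∣≤ε⇒x≃y : ∀ {x y} → (∀ ε → 0ℚ ℚ.< ε → ∣ x - y ∣ ≤ ofℚ ε) → x ≃ y
  ∣x-y∣≤ε⇒x≃y {x} {y} near = mk≃ λ ε 0<ε →
    -- Half of `ε` is the hypothesis' bound, the other half the slack built into `_≤_`.
    ev-map (λ n → ≡.subst (ℚ.∣ seq x n ℚ.- seq y n ∣ ℚ.<_) (half-sum ε))
      (below (near (½ ℚ.* ε) (half-pos 0<ε)) (½ ℚ.* ε) (half-pos 0<ε))

  -- A single Riemann sum, fine enough for both hypotheses, lies within `ε / 2` of each value.
  HasIntegralℚ-unique : ∀ {f I J} → HasIntegralℚ 0ℝ 1ℝ f I → HasIntegralℚ 0ℝ 1ℝ f J → I ≃ J
  HasIntegralℚ-unique {f} {I} {J} int-I int-J = ∣x-y∣≤ε⇒x≃y λ ε 0<ε →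
    let (δ , 0<δ , near-I)   = approx int-I (½ ℚ.* ε) (half-pos 0<ε)
        (δ′ , 0<δ′ , near-J) = approx int-J (½ ℚ.* ε) (half-pos 0<ε)
        (_ , P , fine)       = finePartition (⊓-pos 0<δ 0<δ′)
    in squeeze ε (riemannSum f P)
         (near-I P λ i → ≤-trans (fine i) (≤-pointwise λ _ → ℚ.p⊓q≤p δ δ′))
         (near-J P λ i → ≤-trans (fine i) (≤-pointwise λ _ → ℚ.p⊓q≤q δ δ′))
    where
    open ℝ-Reasoning
    squeeze : ∀ ε S → ∣ S - I ∣ ≤ ofℚ (½ ℚ.* ε) → ∣ S - J ∣ ≤ ofℚ (½ ℚ.* ε) → ∣ I - J ∣ ≤ ofℚ ε
    squeeze ε S near-I near-J = begin
      ∣ I - J ∣                      ≈⟨ ∣∣-cong (R.solve 3 (λ i j s → i R.:- j R.:= (i R.:- s) R.:+ (s R.:- j)) ≃-refl I J S) ⟩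
      ∣ (I - S) + (S - J) ∣          ≲⟨ ∣x+y∣≤ (I - S) (S - J) ⟩
      ∣ I - S ∣ + ∣ S - J ∣          ≈⟨ +-congʳ (≡⇒≃ λ n → dist-sym (seq I n) (seq S n)) ⟩
      ∣ S - I ∣ + ∣ S - J ∣          ≲⟨ +-mono-≤ near-I near-J ⟩
      ofℚ (½ ℚ.* ε) + ofℚ (½ ℚ.* ε)  ≈⟨ ≡⇒≃ (λ _ → half-sum ε) ⟩
      ofℚ ε                          ∎

-- Pointwise expansions of the integrands and their integration

∫binom[t-x] ∫binom[x-t] : ℕ → ℝ → ℝ
∫binom[t-x] n x = ∫ 0ℝ 1ℝ (λ t → binom (t - x) n) (binom[t-x]-integrable n x)
∫binom[x-t] n x = ∫ 0ℝ 1ℝ (λ t → binom (x - t) n) (binom[x-t]-integrable n x)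

abstract

  binom[t-x]-hasIntegral : ∀ n x → HasIntegralℚ 0ℝ 1ℝ (λ t → binom (t - x) n) (∫binom[t-x] n x)
  binom[t-x]-hasIntegral n x = toHasIntegralℚ (proj₂ (binom[t-x]-integrable n x))

  binom[x-t]-hasIntegral : ∀ n x → HasIntegralℚ 0ℝ 1ℝ (λ t → binom (x - t) n) (∫binom[x-t] n x)
  binom[x-t]-hasIntegral n x = toHasIntegralℚ (proj₂ (binom[x-t]-integrable n x))

  -- Shaped for integration: constants stand on the left as in `HasIntegralℚ-*`, and `0ℝ - t`
  -- matches the integrand of the Cauchy numbers literally.
  binom[t-x]-expansion : ∀ n x t → binom (t - x) n ≃
    (- 1ℝ) ^ n * (∑[ m ≤ n ] (binom (x + ofℕ n - 1ℝ) (n ∸ toℕ m) * binom (0ℝ - t) (toℕ m)))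
  binom[t-x]-expansion n x t = begin-equality
    binom (t - x) n
      ≈⟨ binom-negation (t - x) n ⟩
    (- 1ℝ) ^ n * binom (ofℕ n - 1ℝ - (t - x)) n
      ≈⟨ *-congˡ (binom-cong n (R.solve 3 (λ c x t → c R.:- R.con 1ℚ R.:- (t R.:- x) R.:=
           (R.con 0ℚ R.:- t) R.:+ (x R.:+ c R.:- R.con 1ℚ)) ≃-refl (ofℕ n) x t)) ⟩
    (- 1ℝ) ^ n * binom (0ℝ - t + (x + ofℕ n - 1ℝ)) n
      ≈⟨ *-congˡ (vandermonde (0ℝ - t) (x + ofℕ n - 1ℝ) n) ⟩
    (- 1ℝ) ^ n * (binom (0ℝ - t) ⋆ binom (x + ofℕ n - 1ℝ)) n
      ≈⟨ *-congˡ (sum-cong-≋ {suc n} λ m → *-comm (binom (0ℝ - t) (toℕ m)) (binom (x + ofℕ n - 1ℝ) (n ∸ toℕ m))) ⟩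
    (- 1ℝ) ^ n * (∑[ m ≤ n ] (binom (x + ofℕ n - 1ℝ) (n ∸ toℕ m) * binom (0ℝ - t) (toℕ m))) ∎
    where open ℝ-Reasoning

  -1^-involutive : ∀ n → (- 1ℝ) ^ n * (- 1ℝ) ^ n ≃ 1ℝ
  -1^-involutive zero    = *-identityˡ 1ℝ
  -1^-involutive (suc n) = ≃-trans
    (R.solve 1 (λ s → (R.:- R.con 1ℚ R.:* s) R.:* (R.:- R.con 1ℚ R.:* s) R.:= s R.:* s) ≃-refl ((- 1ℝ) ^ n))
    (-1^-involutive n)

  -- Negation is used twice: once before Vandermonde, then on the second factor of each term, which
  -- turns `n - 1 - x` into `x - m`. The signs combine to `(-1)ⁿ (-1)ⁿ⁻ᵐ = (-1)ᵐ`.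
  binom[x-t]-expansion : ∀ n x t → binom (x - t) n ≃
    ∑[ m ≤ n ] ((- 1ℝ) ^ toℕ m * binom (x - ofℕ (toℕ m)) (n ∸ toℕ m) * binom (t - 0ℝ) (toℕ m))
  binom[x-t]-expansion n x t = begin-equality
    binom (x - t) n
      ≈⟨ binom-negation (x - t) n ⟩
    S * binom (ofℕ n - 1ℝ - (x - t)) n
      ≈⟨ *-congˡ (binom-cong n (R.solve 3 (λ c x t → c R.:- R.con 1ℚ R.:- (x R.:- t) R.:=
           (t R.:- R.con 0ℚ) R.:+ (c R.:- R.con 1ℚ R.:- x)) ≃-refl (ofℕ n) x t)) ⟩
    S * binom (t - 0ℝ + (ofℕ n - 1ℝ - x)) n
      ≈⟨ *-congˡ (vandermonde (t - 0ℝ) (ofℕ n - 1ℝ - x) n) ⟩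
    S * (binom (t - 0ℝ) ⋆ binom (ofℕ n - 1ℝ - x)) n
      ≈⟨ *-distribˡ-sum {suc n} S (λ m → binom (t - 0ℝ) (toℕ m) * binom (ofℕ n - 1ℝ - x) (n ∸ toℕ m)) ⟩
    ∑[ m ≤ n ] (S * (binom (t - 0ℝ) (toℕ m) * binom (ofℕ n - 1ℝ - x) (n ∸ toℕ m)))
      ≈⟨ sum-cong-≋ {suc n} (λ m → term (toℕ m) (n ∸ toℕ m) (≡.sym (ℕ.m+[n∸m]≡n (toℕ≤pred[n] m)))) ⟩
    ∑[ m ≤ n ] ((- 1ℝ) ^ toℕ m * binom (x - ofℕ (toℕ m)) (n ∸ toℕ m) * binom (t - 0ℝ) (toℕ m)) ∎
    where
    open ℝ-Reasoning
    S : ℝ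
    S = (- 1ℝ) ^ n

    -- Taking `k` with an equation in place of `n ∸ m` lets `refl` turn `n` into `m + k`, so that
    -- the power of `-1` factors.
    term : ∀ m k → n ≡ m ℕ.+ k → S * (binom (t - 0ℝ) m * binom (ofℕ n - 1ℝ - x) k) ≃
           (- 1ℝ) ^ m * binom (x - ofℕ m) k * binom (t - 0ℝ) m
    term m k refl = begin-equality
      S * (T * binom (ofℕ n - 1ℝ - x) k)
        ≈⟨ *-cong (^-homo-* (- 1ℝ) m k) (*-congˡ (≃-trans (binom-negation (ofℕ n - 1ℝ - x) k)
             (*-congˡ (binom-cong k (≃-trans (+-congˡ (-‿cong (+-congʳ (+-congʳ (ofℕ-+ m k)))))
               (R.solve 3 (λ m k x → k R.:- R.con 1ℚ R.:- (m R.:+ k R.:- R.con 1ℚ R.:- x) R.:= x R.:- m) ≃-refl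
                 (ofℕ m) (ofℕ k) x)))))) ⟩
      M * K * (T * (K * X))
        ≈⟨ R.solve 4 (λ M K T X → M R.:* K R.:* (T R.:* (K R.:* X)) R.:= (K R.:* K) R.:* (M R.:* X R.:* T)) ≃-refl M K T X ⟩
      K * K * (M * X * T)
        ≈⟨ *-congʳ (-1^-involutive k) ⟩
      1ℝ * (M * X * T)
        ≈⟨ *-identityˡ (M * X * T) ⟩
      M * X * T ∎
      where
      M K T X : ℝ
      M = (- 1ℝ) ^ m
      K = (- 1ℝ) ^ k
      T = binom (t - 0ℝ) m
      X = binom (x - ofℕ m) k

  -- Both sides integrate the expanded function: the left by congruence, the right term by term.
  ∫binom[t-x]-expansion : ∀ n x → ∫binom[t-x] n x ≃
    (- 1ℝ) ^ n * (∑[ m ≤ n ] (binom (x + ofℕ n - 1ℝ) (n ∸ toℕ m) * ∫binom[x-t] (toℕ m) 0ℝ))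
  ∫binom[t-x]-expansion n x = HasIntegralℚ-unique
    (HasIntegralℚ-cong (binom[t-x]-expansion n x) (binom[t-x]-hasIntegral n x))
    (HasIntegralℚ-* ((- 1ℝ) ^ n) (HasIntegralℚ-sum {n = suc n} λ m →
      HasIntegralℚ-* (binom (x + ofℕ n - 1ℝ) (n ∸ toℕ m)) (binom[x-t]-hasIntegral (toℕ m) 0ℝ)))

  ∫binom[x-t]-expansion : ∀ n x → ∫binom[x-t] n x ≃
    ∑[ m ≤ n ] ((- 1ℝ) ^ toℕ m * binom (x - ofℕ (toℕ m)) (n ∸ toℕ m) * ∫binom[t-x] (toℕ m) 0ℝ)
  ∫binom[x-t]-expansion n x = HasIntegralℚ-unique
    (HasIntegralℚ-cong (binom[x-t]-expansion n x) (binom[x-t]-hasIntegral n x))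
    (HasIntegralℚ-sum {n = suc n} λ m →
      HasIntegralℚ-* ((- 1ℝ) ^ toℕ m * binom (x - ofℕ (toℕ m)) (n ∸ toℕ m))
        (binom[t-x]-hasIntegral (toℕ m) 0ℝ))

-- From the integrals to Cauchy polynomials and numbers

theorem2 : (n : ℕ) (x : ℝ) →
    (cauchyPoly₁ n x ≃ (- 1ℝ) ^ n * ofℕ (n !) *
    (∑[ m ≤ n ] (cauchyNumber₂ (toℕ m) /! toℕ m * binom (x + ofℕ n - 1ℝ) (n ∸ toℕ m))))
    ×
    (cauchyPoly₂ n x ≃ ofℕ (n !) *
    (∑[ m ≤ n ] ((- 1ℝ) ^ toℕ m * cauchyNumber₁ (toℕ m) /! toℕ m * binom (x - ofℕ (toℕ m)) (n ∸ toℕ m))))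
theorem2 n x = first-kind , second-kind
  where
  open ℝ-Reasoning

  first-kind : cauchyPoly₁ n x ≃ (- 1ℝ) ^ n * ofℕ (n !) *
    (∑[ m ≤ n ] (cauchyNumber₂ (toℕ m) /! toℕ m * binom (x + ofℕ n - 1ℝ) (n ∸ toℕ m)))
  first-kind = begin-equality
    ofℕ (n !) * ∫binom[t-x] n x
      ≈⟨ *-congˡ (∫binom[t-x]-expansion n x) ⟩
    ofℕ (n !) * ((- 1ℝ) ^ n * (∑[ m ≤ n ] (binom (x + ofℕ n - 1ℝ) (n ∸ toℕ m) * ∫binom[x-t] (toℕ m) 0ℝ)))
      ≈⟨ R.solve 3 (λ c s X → c R.:* (s R.:* X) R.:= s R.:* c R.:* X) ≃-refl (ofℕ (n !)) ((- 1ℝ) ^ n) _ ⟩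
    (- 1ℝ) ^ n * ofℕ (n !) * (∑[ m ≤ n ] (binom (x + ofℕ n - 1ℝ) (n ∸ toℕ m) * ∫binom[x-t] (toℕ m) 0ℝ))
      -- Each integral is rewritten as `m !` times itself over `m !`; the numerator is the Cauchy
      -- number by definition.
      ≈⟨ *-congˡ (sum-cong-≋ {suc n} λ m → ≃-trans
           (*-comm (binom (x + ofℕ n - 1ℝ) (n ∸ toℕ m)) (∫binom[x-t] (toℕ m) 0ℝ))
           (*-congʳ {binom (x + ofℕ n - 1ℝ) (n ∸ toℕ m)} (≃-sym (!*x/!≃x (toℕ m) (∫binom[x-t] (toℕ m) 0ℝ))))) ⟩
    (- 1ℝ) ^ n * ofℕ (n !) *
      (∑[ m ≤ n ] (cauchyNumber₂ (toℕ m) /! toℕ m * binom (x + ofℕ n - 1ℝ) (n ∸ toℕ m))) ∎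

  second-kind : cauchyPoly₂ n x ≃ ofℕ (n !) *
    (∑[ m ≤ n ] ((- 1ℝ) ^ toℕ m * cauchyNumber₁ (toℕ m) /! toℕ m * binom (x - ofℕ (toℕ m)) (n ∸ toℕ m)))
  second-kind = *-congˡ (≃-trans (∫binom[x-t]-expansion n x) (sum-cong-≋ {suc n} λ m → term (toℕ m) (n ∸ toℕ m)))
    where
    term : ∀ m k → (- 1ℝ) ^ m * binom (x - ofℕ m) k * ∫binom[t-x] m 0ℝ ≃
           (- 1ℝ) ^ m * cauchyNumber₁ m /! m * binom (x - ofℕ m) k
    term m k = begin-equality
      s * X * I
        ≈⟨ *-congˡ (!*x/!≃x m I) ⟨
      s * X * (ofℕ (m !) * I /! m)
        ≈⟨ R.solve 5 (λ s X c I r → s R.:* X R.:* (c R.:* I R.:* r) R.:= s R.:* (c R.:* I) R.:* r R.:* X) ≃-refl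
             s X (ofℕ (m !)) I (1/! m) ⟩
      s * (ofℕ (m !) * I) /! m * X ∎
      where
      s X I : ℝ
      s = (- 1ℝ) ^ m
      X = binom (x - ofℕ m) k
      I = ∫binom[t-x] m 0ℝ
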